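{- For any $k\ge 3$ and any $\epsilon>0$, there exist a constant $c>0$ and a distribution of instances of $k$-XOS maximization such that any randomized $(k-1-\epsilon)$-approximation algorithm calls the value oracle at least $\delta\cdot 2^{\Omega(n^c)}$ times with probability at least $1-\delta$ for any $0<\delta<1$.
   Context: A set function $f\colon 2^V\to\mathbb{R}$ on a finite set $V$ is additive if $f(X)=\sum_{v\in X}f(\{v\})$ for all $X\subseteq V$. For a positive integer $k$, it is $k$-XOS if there are additive functions $f_1,\dots,f_k\colon 2^V\to\mathbb{R}$ (values may be negative) such that $f(X)=\max_{1\le i\le k}f_i(X)$ for all $X\subseteq V$. $k$-XOS maximization: given a $k$-XOS function $f$ on $V$, with $n=|V|$, accessible only through a value oracle (a query $X\subseteq V$ returns $f(X)$), find $X\subseteq V$ maximizing $f(X)$. Here $k$ is a fixed constant. For $\alpha\ge 1$, a randomized algorithm is an $\alpha$-approximation algorithm if the expected function value of its output is at least $\frac{1}{\alpha}\cdot\max_{X\subseteq V}f(X)$.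
   Formalization: The probability 1-δ is over the random instance only, and the number of oracle calls is the expected number over the algorithm's coins; with coins in the probability the claim fails (query all sets with probability 1/α, else output ∅). -}

module Defs where

open import Algebra.Bundles using (CommutativeRing; CommutativeMonoid)
open import Algebra.Structures using (IsCommutativeRing)
open import Data.Bool.Base using (if_then_else_)
open import Data.Fin.Base using (Fin)
open import Data.Fin.Subset using (Subset; ⁅_⁆)
open import Data.Integer.Base using (∣_∣)
open import Data.Nat.Base as ℕ using (ℕ; zero; suc)
open import Data.Product.Base using (_×_; Σ-syntax; ∃-syntax)
open import Data.Rational.Base using (ℚ; ↥_; ↧ₙ_)
open import Data.Vec.Base using (lookup)
open import Level using (Level; _⊔_) renaming (suc to lsuc)
open import Relation.Binary.Core using (Rel)
open import Relation.Binary.PropositionalEquality.Core using (_≡_; _≢_)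
open import Relation.Binary.Structures using (IsDecTotalOrder)
open import Relation.Nullary.Decidable.Core using (does)
open import Relation.Unary using (Pred; Decidable)
import Algebra.Definitions.RawMonoid as RawMonoidDefinitions
import Relation.Binary.Construct.NonStrictToStrict as ToStrict

-- The standard library has no real numbers, so "real number" means: element
-- of an arbitrary Archimedean ordered field with decidable order.  Classically
-- these are, up to isomorphism, the subfields of ℝ, ℝ itself among them.  Completeness is
-- not required; in this way ℚ is an instance too, and the notion is inhabited
-- constructively.
record ArchimedeanOrderedField (a ℓ : Level) : Set (lsuc (a ⊔ ℓ)) where
  infixl 6 _+_ _-_
  infixl 7 _*_
  infix  8 -_
  infix  9 _⁻¹
  infix  4 _≤_
  field
    Carrier           : Set a
    _+_ _*_           : Carrier → Carrier → Carrier
    -_                : Carrier → Carrier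
    0# 1#             : Carrier
    -- 0# ⁻¹ is unconstrained.
    _⁻¹               : Carrier → Carrier
    _≤_               : Rel Carrier ℓ
    isCommutativeRing : IsCommutativeRing _≡_ _+_ _*_ -_ 0# 1#
    0≢1               : 0# ≢ 1#
    *-inverseʳ        : ∀ x → x ≢ 0# → x * x ⁻¹ ≡ 1#
    isDecTotalOrder   : IsDecTotalOrder _≡_ _≤_
    +-monoʳ-≤         : ∀ z {x y} → x ≤ y → z + x ≤ z + y
    *-nonNegative     : ∀ {x y} → 0# ≤ x → 0# ≤ y → 0# ≤ x * y

  commutativeRing : CommutativeRing a a
  commutativeRing = record { isCommutativeRing = isCommutativeRing }

  open IsDecTotalOrder isDecTotalOrder public using (_≤?_)
  open ToStrict _≡_ _≤_ public using () renaming (_<_ to infix 4 _<_)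
  open RawMonoidDefinitions
    (CommutativeMonoid.rawMonoid (CommutativeRing.+-commutativeMonoid commutativeRing))
    public using (sum) renaming (_×_ to infixr 8 _·_)

  _-_ : Carrier → Carrier → Carrier
  x - y = x + (- y)

  fromℕ : ℕ → Carrier
  fromℕ n = n · 1#

  field
    archimedean : ∀ x → ∃[ n ] x ≤ fromℕ n

-- g(n) = Ω(n^c) for a rational exponent c = p / q > 0: from some point on,
-- n^(p/q) ≤ C * g(n), with both sides raised to the power q.
_∈Ω[n^_] : (ℕ → ℕ) → ℚ → Set
g ∈Ω[n^ c ] = ∃[ C ] ∃[ N ] ∀ n → N ℕ.≤ n →
  n ℕ.^ ∣ ↥ c ∣ ℕ.≤ (C ℕ.* g n) ℕ.^ (↧ₙ c)

module XOS {a ℓ} (R : ArchimedeanOrderedField a ℓ) where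
  open ArchimedeanOrderedField R

  -- The ground set V with |V| = n is Fin n.
  SetFunction : ℕ → Set a
  SetFunction n = Subset n → Carrier

  ∑[_] : ∀ {n} → Subset n → (Fin n → Carrier) → Carrier
  ∑[ X ] h = sum (λ v → if lookup X v then h v else 0#)

  IsAdditive : ∀ {n} → SetFunction n → Set a
  IsAdditive f = ∀ X → f X ≡ ∑[ X ] (λ v → f ⁅ v ⁆)

  IsMaximum : ∀ {i} {I : Set i} → (I → Carrier) → Carrier → Set (i ⊔ a ⊔ ℓ)
  IsMaximum g m = (∃[ i ] g i ≡ m) × (∀ i → g i ≤ m)

  IsXOS : ℕ → ∀ {n} → SetFunction n → Set (a ⊔ ℓ)
  IsXOS k {n} f = Σ[ fs ∈ (Fin k → SetFunction n) ]
    (∀ i → IsAdditive (fs i)) × (∀ X → IsMaximum (λ i → fs i X) (f X))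

  record Instance (k n : ℕ) : Set (a ⊔ ℓ) where
    field
      function : SetFunction n
      isXOS    : IsXOS k function

  -- Randomized algorithms on a ground set of size n: probabilistic decision
  -- trees, whose only access to the input is through oracle answers.
  data Algorithm (n : ℕ) : Set (a ⊔ ℓ) where
    output : Subset n → Algorithm n
    query  : Subset n → (Carrier → Algorithm n) → Algorithm n
    -- Continue with the first branch with probability p, else the second.
    toss   : (p : Carrier) → 0# ≤ p → p ≤ 1# →
             Algorithm n → Algorithm n → Algorithm n

  -- Expectation, over the coin tosses made on input f, of φ X q, where X is
  -- the output and q is the number of oracle calls.
  𝔼 : ∀ {n} → SetFunction n → Algorithm n → (Subset n → ℕ → Carrier) → Carrier
  𝔼 f (output X)       φ = φ X 0
  𝔼 f (query X κ)      φ = 𝔼 f (κ (f X)) (λ Y q → φ Y (suc q))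
  𝔼 f (toss p _ _ A B) φ = p * 𝔼 f A φ + (1# - p) * 𝔼 f B φ

  expectedValue : ∀ {n} → SetFunction n → Algorithm n → Carrier
  expectedValue f A = 𝔼 f A (λ X _ → f X)

  expectedCalls : ∀ {n} → SetFunction n → Algorithm n → Carrier
  expectedCalls f A = 𝔼 f A (λ _ q → fromℕ q)

  -- Only used for α ≥ 1.
  IsApproximation : ℕ → Carrier → ∀ {n} → Algorithm n → Set (a ⊔ ℓ)
  IsApproximation k α {n} A = ∀ (f : SetFunction n) → IsXOS k f →
    ∀ m → IsMaximum f m → α ⁻¹ * m ≤ expectedValue f A

  record Distribution {b} (B : Set b) : Set (a ⊔ b ⊔ ℓ) where
    field
      size      : ℕ
      outcome   : Fin size → B
      weight    : Fin size → Carrier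
      weight≥0  : ∀ i → 0# ≤ weight i
      weight-∑  : sum weight ≡ 1#

  Pr : ∀ {b p} {B : Set b} → Distribution B → {P : Pred B p} → Decidable P → Carrier
  Pr D P? = sum (λ i → if does (P? (outcome i)) then weight i else 0#)
    where open Distribution D

  -- The probability that a random instance makes A call the oracle at least t
  -- times, where the number of calls on a fixed instance is the expectation
  -- over the coin tosses of A.  The coins must not enter the probability: for
  -- α > 1, querying every subset with probability 1/α and otherwise returning
  -- ∅ (of value 0) is an α-approximation, and on every instance it makes no
  -- call at all with probability 1 - 1/α.
  Pr[calls≥_] : ∀ {k n} → Carrier → Distribution (Instance k n) → Algorithm n → Carrier
  Pr[calls≥ t ] D A = Pr D (λ I → t ≤? expectedCalls (Instance.function I) A)

{-# OPTIONS --safe #-}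
module Submission where

open import Algebra.Bundles using (CommutativeRing)
open import Data.Bool.Base using (true; false; if_then_else_; not)
open import Data.Empty using (⊥-elim)
open import Data.Fin.Base using (Fin; zero; suc; toℕ; combine; finToFun; quotient; remainder; splitAt; _↑ˡ_; _↑ʳ_)
open import Data.Fin.Subset using (Subset; ⁅_⁆) renaming (⊥ to ∅)
open import Data.Nat.Base as ℕ using (ℕ; zero; suc; z≤n; s≤s; NonZero)
open import Data.Nat.Coprimality using (1-coprimeTo)
open import Data.Nat.Solver using (module +-*-Solver)
open import Data.Product.Base using (_×_; _,_; Σ-syntax; ∃-syntax; proj₁; proj₂)
open import Data.Rational.Base as ℚ using (ℚ; 0ℚ; mkℚ)
open import Data.Sum.Base using (_⊎_; inj₁; inj₂; [_,_]′)
open import Data.Vec.Base using (lookup; tabulate)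
open import Data.Vec.Properties using (lookup∘tabulate)
open import Function.Base using (_∘_; const)
open import Relation.Binary.Bundles using (Poset)
open import Relation.Binary.Definitions using (tri<; tri≈; tri>)
open import Relation.Binary.PropositionalEquality using (_≡_; _≢_; refl; sym; trans; cong; cong₂; subst; module ≡-Reasoning)
open import Relation.Binary.Structures using (IsDecTotalOrder)
open import Relation.Nullary using (¬_; yes; no; does)
open import Relation.Unary using (Pred; Decidable)
import Algebra.Properties.Ring as RingProperties
import Algebra.Properties.Semiring.Mult as Mult
import Algebra.Properties.Semiring.Sum as Sum
import Algebra.Solver.Ring.NaturalCoefficients.Default as Solver
import Data.Fin.Properties as Finₚ
import Data.Integer.Base as ℤ
import Data.Nat.Properties as ℕₚ
import Relation.Binary.Reasoning.PartialOrder as PartialOrderReasoning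
open import Defs
open Sum ℕₚ.+-*-semiring using () renaming
  ( sum to ∑; sum-cong-≗ to ∑-cong; ∑-distrib-+ to ∑-+; ∑-comm to ∑-swap
  ; *-distribˡ-sum to *-distribˡ-∑; *-distribʳ-sum to *-distribʳ-∑)

-- Let κ = k - 1.  The ground set has κ classes of blocks of L elements, plus unused elements;
-- class i has q ^ i blocks, of weight proportional to q ^ (-i), so all classes have the
-- same total weight.  In every block b picks one element, the trap.  With w the weight,
-- the class functions g_j = (1 + 1/L) w on class j and 0 elsewhere, and the hidden function
-- h = w off the traps and -∞ (a large negative constant) on them, give the κ + 1 additive
-- functions; the base function is max_j g_j.  The set of all non-traps has about κ times the
-- largest base value.
--
-- A set X tells the instance from the base function only if it avoids all traps, which
-- for random b has probability at most (1 - 1/L) ^ |X|.  If |X| ≤ q / L, it never does: the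
-- classes below the heaviest one met by X weigh so little that 1/L of that one pays
-- for them.  With s = q / L² each X is thus revealing with probability at most 2 ^ (-s).
--
-- The run on a hidden instance agrees with the run on the base function until a
-- revealing set is met.  Abandoning the run with probability θ after each query, an
-- algorithm with N expected calls has value at most u + w (Q + θ N), with u and w the maxima of
-- base and instance and Q the probability that the abandoned run on the base function
-- meets a revealing set.  Averaged over b, Q is at most 2 ^ (-s) / θ.  An approximation
-- algorithm has Q + θ N ≥ 2 / E for a constant E, so taking θ = 1 / (E t) bounds the fraction
-- of instances with N < t by E² t / 2 ^ s.

-- Finite sums of natural numbers and indicator functions.

module _ where
  open import Data.Nat.Base using (_+_; _*_; _^_; _∸_; _⊔_; _≤_; _<_)

  ∑-mono-≤ : ∀ {n} {f g : Fin n → ℕ} → (∀ i → f i ≤ g i) → ∑ f ≤ ∑ g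
  ∑-mono-≤ {zero}  f≤g = z≤n
  ∑-mono-≤ {suc n} f≤g = ℕₚ.+-mono-≤ (f≤g zero) (∑-mono-≤ (f≤g ∘ suc))

  ∑-const : ∀ n x → ∑ {n} (λ _ → x) ≡ n * x
  ∑-const zero    x = refl
  ∑-const (suc n) x = cong (x +_) (∑-const n x)

  ∑-zero : ∀ n → ∑ {n} (λ _ → 0) ≡ 0
  ∑-zero n = trans (∑-const n 0) (ℕₚ.*-zeroʳ n)

  term≤∑ : ∀ {n} (f : Fin n → ℕ) i → f i ≤ ∑ f
  term≤∑ f zero    = ℕₚ.m≤m+n _ _
  term≤∑ f (suc i) = ℕₚ.≤-trans (term≤∑ (f ∘ suc) i) (ℕₚ.m≤n+m _ _)

  ∑≢0⇒∃≢0 : ∀ {n} (f : Fin n → ℕ) → ∑ f ≢ 0 → ∃[ i ] f i ≢ 0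
  ∑≢0⇒∃≢0 {zero}  f ∑≢0 = ⊥-elim (∑≢0 refl)
  ∑≢0⇒∃≢0 {suc n} f ∑≢0 with f zero in eq
  ... | suc x = zero , λ f≡0 → ℕₚ.1+n≢0 (trans (sym eq) f≡0)
  ... | zero  with ∑≢0⇒∃≢0 (f ∘ suc) ∑≢0
  ...   | i , fi≢0 = suc i , fi≢0

  ∑-↑ : ∀ m n (f : Fin (m + n) → ℕ) → ∑ f ≡ ∑ (λ i → f (i ↑ˡ n)) + ∑ (λ j → f (m ↑ʳ j))
  ∑-↑ zero    n f = refl
  ∑-↑ (suc m) n f = trans (cong (f zero +_) (∑-↑ m n (f ∘ suc))) (sym (ℕₚ.+-assoc (f zero) _ _))

  ∑-combine : ∀ m n (f : Fin (m * n) → ℕ) → ∑ f ≡ ∑ {m} (λ i → ∑ {n} (λ j → f (combine i j)))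
  ∑-combine zero    n f = refl
  ∑-combine (suc m) n f = trans (∑-↑ n (m * n) f) (cong (∑ (λ j → f (j ↑ˡ (m * n))) +_) (∑-combine m n (λ i → f (n ↑ʳ i))))

  quotient-combine : ∀ {m n} (i : Fin m) (j : Fin n) → quotient n (combine i j) ≡ i
  quotient-combine i j = cong proj₁ (Finₚ.remQuot-combine i j)

  remainder-combine : ∀ {m n} (i : Fin m) (j : Fin n) → remainder {m} n (combine i j) ≡ j
  remainder-combine i j = cong proj₂ (Finₚ.remQuot-combine i j)

  δ : ∀ {n} → Fin n → Fin n → ℕ
  δ i j = if does (i Finₚ.≟ j) then 1 else 0

  δ-refl : ∀ {n} (i : Fin n) → δ i i ≡ 1
  δ-refl i with i Finₚ.≟ i
  ... | yes _   = refl
  ... | no  i≢i = ⊥-elim (i≢i refl)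

  δ≢0⇒≡ : ∀ {n} (i j : Fin n) → δ i j ≢ 0 → i ≡ j
  δ≢0⇒≡ i j δ≢0 with i Finₚ.≟ j
  ... | yes i≡j = i≡j
  ... | no  _   = ⊥-elim (δ≢0 refl)

  δ-suc : ∀ {n} (i j : Fin n) → δ (suc i) (suc j) ≡ δ i j
  δ-suc i j with i Finₚ.≟ j
  ... | yes _ = refl
  ... | no  _ = refl

  ∑-*-δ : ∀ {n} (f : Fin n → ℕ) j → ∑ (λ i → f i * δ i j) ≡ f j
  ∑-*-δ {suc n} f zero = begin
    f zero * 1 + ∑ (λ i → f (suc i) * 0)  ≡⟨ cong₂ _+_ (ℕₚ.*-identityʳ (f zero)) (∑-cong {n} (λ i → ℕₚ.*-zeroʳ (f (suc i)))) ⟩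
    f zero + ∑ {n} (λ _ → 0)              ≡⟨ cong (f zero +_) (∑-zero n) ⟩
    f zero + 0                            ≡⟨ ℕₚ.+-identityʳ (f zero) ⟩
    f zero                                ∎
    where open ≡-Reasoning
  ∑-*-δ f (suc j) = begin
    f zero * 0 + ∑ (λ i → f (suc i) * δ (suc i) (suc j))
      ≡⟨ cong₂ _+_ (ℕₚ.*-zeroʳ (f zero)) (∑-cong (λ i → cong (f (suc i) *_) (δ-suc i j))) ⟩
    ∑ (λ i → f (suc i) * δ i j)
      ≡⟨ ∑-*-δ (f ∘ suc) j ⟩
    f (suc j) ∎
    where open ≡-Reasoning

  ∑-<ᵇ : ∀ n c → c ≤ n → ∑ {n} (λ i → if toℕ i ℕ.<ᵇ c then 1 else 0) ≡ c
  ∑-<ᵇ n       zero    _         = trans (∑-cong {n} (λ _ → refl)) (∑-zero n)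
  ∑-<ᵇ (suc n) (suc c) (s≤s c≤n) = cong suc (∑-<ᵇ n c c≤n)

  -- Maxima and searches over finite index sets.

  ⨆ : ∀ {n} → (Fin n → ℕ) → ℕ
  ⨆ {zero}  f = 0
  ⨆ {suc n} f = f zero ⊔ ⨆ (f ∘ suc)

  ≤⨆ : ∀ {n} (f : Fin n → ℕ) i → f i ≤ ⨆ f
  ≤⨆ f zero    = ℕₚ.m≤m⊔n _ _
  ≤⨆ f (suc i) = ℕₚ.≤-trans (≤⨆ (f ∘ suc) i) (ℕₚ.m≤n⊔m (f zero) _)

  ⨆-attained : ∀ {n} (f : Fin (suc n) → ℕ) → ∃[ i ] f i ≡ ⨆ f
  ⨆-attained {zero}  f = zero , sym (ℕₚ.⊔-identityʳ (f zero))
  ⨆-attained {suc n} f with ℕₚ.⊔-sel (f zero) (⨆ (f ∘ suc)) | ⨆-attained (f ∘ suc)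
  ... | inj₁ eq | _      = zero , sym eq
  ... | inj₂ eq | i , fi = suc i , trans fi (sym eq)

  ⨆-≤ : ∀ {n x} {f : Fin n → ℕ} → (∀ i → f i ≤ x) → ⨆ f ≤ x
  ⨆-≤ {zero}  f≤x = z≤n
  ⨆-≤ {suc n} f≤x = ℕₚ.⊔-lub (f≤x zero) (⨆-≤ (f≤x ∘ suc))

  -- Serves to find the heaviest class met by a set: weights fall as the index grows, so it is the
  -- first class of nonzero weight.
  least-counterexample : ∀ {n p} {P : Pred (Fin n) p} → Decidable P →
    (∀ i → P i) ⊎ (∃[ i ] ¬ P i × (∀ j → toℕ j < toℕ i → P j))
  least-counterexample {zero}  P? = inj₁ λ ()
  least-counterexample {suc n} P? with P? zero
  ... | no ¬p = inj₂ (zero , ¬p , λ _ ())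
  ... | yes p with least-counterexample (P? ∘ suc)
  ...   | inj₁ ∀P           = inj₁ λ { zero → p ; (suc i) → ∀P i }
  ...   | inj₂ (i , ¬pᵢ , below) = inj₂ (suc i , ¬pᵢ , λ { zero _ → p ; (suc j) (s≤s j<i) → below j j<i })

  -- Counting the choices that avoid a given set of positions.

  isZero : ℕ → ℕ
  isZero zero    = 1
  isZero (suc _) = 0

  -- Avoidance in all blocks is a product of avoidances in single blocks; this is what makes the
  -- blocks independent.
  isZero-+ : ∀ m n → isZero (m + n) ≡ isZero m * isZero n
  isZero-+ zero    n = sym (ℕₚ.+-identityʳ (isZero n))
  isZero-+ (suc m) n = refl

  ∑-isZero : ∀ {n} (y : Fin n → ℕ) → (∀ i → y i ≤ 1) → ∑ (isZero ∘ y) + ∑ y ≡ n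
  ∑-isZero {zero}  y y≤1 = refl
  ∑-isZero {suc n} y y≤1 with y zero | y≤1 zero
  ... | 0 | _ = cong suc (∑-isZero (y ∘ suc) (y≤1 ∘ suc))
  ... | 1 | _ = trans (ℕₚ.+-suc _ _) (cong suc (∑-isZero (y ∘ suc) (y≤1 ∘ suc)))
  ... | suc (suc _) | s≤s ()

  -- Bernoulli's inequality with denominators cleared, for `L = suc l` and `c = L - a`. Each step of
  -- the induction replaces `c` by `suc c`, which costs a factor `c / (c + 1)`, at most `l / L`
  -- because `c ≤ l`.
  [1-a/L]≤[1-1/L]^a : ∀ l c a → c + a ≡ suc l → c * suc l ^ a ≤ suc l * l ^ a
  [1-a/L]≤[1-1/L]^a l c zero    c+a≡L = ℕₚ.*-monoˡ-≤ 1 (ℕₚ.≤-reflexive (trans (sym (ℕₚ.+-identityʳ c)) c+a≡L))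
  [1-a/L]≤[1-1/L]^a l c (suc a) c+a≡L = begin
    c * (suc l * suc l ^ a)    ≡⟨ ℕₚ.*-assoc c (suc l) _ ⟨
    (c * suc l) * suc l ^ a    ≤⟨ ℕₚ.*-monoˡ-≤ (suc l ^ a) cL≤ ⟩
    (l * suc c) * suc l ^ a    ≡⟨ ℕₚ.*-assoc l (suc c) _ ⟩
    l * (suc c * suc l ^ a)    ≤⟨ ℕₚ.*-monoʳ-≤ l ([1-a/L]≤[1-1/L]^a l (suc c) a (trans (sym (ℕₚ.+-suc c a)) c+a≡L)) ⟩
    l * (suc l * l ^ a)        ≡⟨ solve 3 (λ l m x → l :* (m :* x) := m :* (l :* x)) refl l (suc l) (l ^ a) ⟩
    suc l * (l * l ^ a)        ∎
    where
    open ℕₚ.≤-Reasoning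
    open +-*-Solver
    c≤l : c ≤ l
    c≤l = ℕ.s≤s⁻¹ (subst (suc c ≤_) (trans (sym (ℕₚ.+-suc c a)) c+a≡L) (s≤s (ℕₚ.m≤m+n c a)))
    cL≤ : c * suc l ≤ l * suc c
    cL≤ = begin
      c * suc l   ≡⟨ ℕₚ.*-suc c l ⟩
      c + c * l   ≤⟨ ℕₚ.+-mono-≤ c≤l (ℕₚ.≤-reflexive (ℕₚ.*-comm c l)) ⟩
      l + l * c   ≡⟨ ℕₚ.*-suc l c ⟨
      l * suc c   ∎

  ∑∑ : ∀ {m n} → (Fin m → Fin n → ℕ) → ℕ
  ∑∑ f = ∑ λ i → ∑ (f i)

  ∑∑-mono-≤ : ∀ {m n} {f g : Fin m → Fin n → ℕ} → (∀ i j → f i j ≤ g i j) → ∑∑ f ≤ ∑∑ g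
  ∑∑-mono-≤ f≤g = ∑-mono-≤ λ i → ∑-mono-≤ (f≤g i)

  ∑∑-cong : ∀ {m n} {f g : Fin m → Fin n → ℕ} → (∀ i j → f i j ≡ g i j) → ∑∑ f ≡ ∑∑ g
  ∑∑-cong f≡g = ∑-cong λ i → ∑-cong (f≡g i)

  ∑∑-+ : ∀ {m n} (f g : Fin m → Fin n → ℕ) → ∑∑ (λ i j → f i j + g i j) ≡ ∑∑ f + ∑∑ g
  ∑∑-+ f g = trans (∑-cong λ i → ∑-+ (f i) (g i)) (∑-+ (λ i → ∑ (f i)) (λ i → ∑ (g i)))

  *-distribˡ-∑∑ : ∀ {m n} c (f : Fin m → Fin n → ℕ) → c * ∑∑ f ≡ ∑∑ (λ i j → c * f i j)
  *-distribˡ-∑∑ c f = trans (*-distribˡ-∑ c (λ i → ∑ (f i))) (∑-cong λ i → *-distribˡ-∑ c (f i))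

  *-distribʳ-∑∑ : ∀ {m n} c (f : Fin m → Fin n → ℕ) → ∑∑ f * c ≡ ∑∑ (λ i j → f i j * c)
  *-distribʳ-∑∑ c f = trans (*-distribʳ-∑ c (λ i → ∑ (f i))) (∑-cong λ i → *-distribʳ-∑ c (f i))

  term≤∑∑ : ∀ {m n} (f : Fin m → Fin n → ℕ) i j → f i j ≤ ∑∑ f
  term≤∑∑ f i j = ℕₚ.≤-trans (term≤∑ (f i) j) (term≤∑ (λ i → ∑ (f i)) i)

  ∑∑≢0⇒∃≢0 : ∀ {m n} (f : Fin m → Fin n → ℕ) → ∑∑ f ≢ 0 → ∃[ i ] ∃[ j ] f i j ≢ 0
  ∑∑≢0⇒∃≢0 f ∑∑≢0 with ∑≢0⇒∃≢0 (λ i → ∑ (f i)) ∑∑≢0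
  ... | i , ∑≢0 = i , ∑≢0⇒∃≢0 (f i) ∑≢0

  ∑∑≡0 : ∀ {m n} {f : Fin m → Fin n → ℕ} → (∀ i j → f i j ≡ 0) → ∑∑ f ≡ 0
  ∑∑≡0 {m} {n} f≡0 = trans (∑∑-cong f≡0) (trans (∑-cong {m} λ _ → ∑-zero n) (∑-zero m))

  ∑∑-const : ∀ {m} n (f : Fin m → ℕ) → ∑∑ {m} {n} (λ i _ → f i) ≡ n * ∑ f
  ∑∑-const n f = trans (∑-cong λ i → ∑-const n (f i)) (sym (*-distribˡ-∑ n f))

  -- One factor [1-a/L]≤[1-1/L]^a per block: the L ^ B choices of one position in
  -- each block are independent.
  avoiding-choices : ∀ {B} l (y : Fin B → Fin (suc l) → ℕ) → (∀ β p → y β p ≤ 1) →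
    ∑ (λ b → isZero (∑ λ β → y β (finToFun b β))) * suc l ^ ∑∑ y ≤ l ^ ∑∑ y * suc l ^ B
  avoiding-choices {zero}  l y y≤1 = ℕₚ.≤-refl
  avoiding-choices {suc B} l y y≤1 = begin
    ∑ (λ b → isZero (∑ λ β → y β (finToFun b β))) * L ^ (∑ (y zero) + c)
      ≡⟨ cong₂ _*_ factor (ℕₚ.^-distribˡ-+-* L (∑ (y zero)) c) ⟩
    (Y * A) * (L ^ ∑ (y zero) * L ^ c)
      ≡⟨ solve 4 (λ Y A u v → (Y :* A) :* (u :* v) := (Y :* u) :* (A :* v)) refl Y A (L ^ ∑ (y zero)) (L ^ c) ⟩
    (Y * L ^ ∑ (y zero)) * (A * L ^ c)
      ≤⟨ ℕₚ.*-mono-≤ ([1-a/L]≤[1-1/L]^a l Y (∑ (y zero)) (∑-isZero (y zero) (y≤1 zero)))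
           (avoiding-choices l (y ∘ suc) (y≤1 ∘ suc)) ⟩
    (L * l ^ ∑ (y zero)) * (l ^ c * L ^ B)
      ≡⟨ solve 4 (λ Y A u v → (Y :* A) :* (u :* v) := (A :* u) :* (Y :* v)) refl L (l ^ ∑ (y zero)) (l ^ c) (L ^ B) ⟩
    (l ^ ∑ (y zero) * l ^ c) * (L * L ^ B)
      ≡⟨ cong (_* (L * L ^ B)) (ℕₚ.^-distribˡ-+-* l (∑ (y zero)) c) ⟨
    l ^ (∑ (y zero) + c) * L ^ suc B ∎
    where
    open ℕₚ.≤-Reasoning
    open +-*-Solver
    L c Y A : ℕ
    L = suc l
    c = ∑∑ (y ∘ suc)
    Y = ∑ (isZero ∘ y zero)
    avoided : Fin (L ^ B) → ℕ
    avoided b = isZero (∑ λ β → y (suc β) (finToFun b β))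
    A = ∑ avoided
    -- `combine` puts the choice for the first block in front of the code of the remaining choices,
    -- so the avoidance indicator factors.
    split : ∀ p b → isZero (∑ λ β → y β (finToFun {L} {suc B} (combine p b) β)) ≡ isZero (y zero p) * avoided b
    split p b = trans
      (cong isZero (cong₂ _+_ (cong (y zero) (quotient-combine p b))
        (∑-cong λ β → cong (λ b′ → y (suc β) (finToFun b′ β)) (remainder-combine p b))))
      (isZero-+ (y zero p) _)
    factor : ∑ (λ b → isZero (∑ λ β → y β (finToFun {L} {suc B} b β))) ≡ Y * A
    factor = trans (∑-combine L (L ^ B) _)
      (trans (∑-cong λ p → trans (∑-cong (split p)) (sym (*-distribˡ-∑ (isZero (y zero p)) avoided)))
        (sym (*-distribʳ-∑ A (isZero ∘ y zero))))

  -- The right side expands binomially; the left side consists of its two leading terms.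
  bernoulli : ∀ l m → l ^ suc m + suc m * l ^ m ≤ suc l ^ suc m
  bernoulli l zero    = ℕₚ.≤-reflexive (solve 1 (λ l → l :* con 1 :+ con 1 := (con 1 :+ l) :* con 1) refl l)
    where open +-*-Solver
  bernoulli l (suc m) = begin
    l * x + (x + suc m * x)                        ≤⟨ ℕₚ.m≤m+n _ (suc m * l ^ m) ⟩
    l * x + (x + suc m * x) + suc m * l ^ m        ≡⟨ solve 3 (λ l y m → l :* (l :* y) :+ (l :* y :+ m :* (l :* y)) :+ m :* y :=
                                                        (con 1 :+ l) :* (l :* y :+ m :* y)) refl l (l ^ m) (suc m) ⟩
    suc l * (x + suc m * l ^ m)                    ≤⟨ ℕₚ.*-monoʳ-≤ (suc l) (bernoulli l m) ⟩
    suc l * suc l ^ suc m                          ∎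
    where
    open ℕₚ.≤-Reasoning
    open +-*-Solver
    x : ℕ
    x = l ^ suc m

  -- This is `(1 - 1/L) ^ L ≤ 1/2`: in `bernoulli` with `m = l` the second term is at least the
  -- first.
  2*l^L≤L^L : ∀ l → 2 * l ^ suc l ≤ suc l ^ suc l
  2*l^L≤L^L l = begin
    l ^ suc l + (l ^ suc l + 0)    ≡⟨ cong (l ^ suc l +_) (ℕₚ.+-identityʳ _) ⟩
    l ^ suc l + l * l ^ l          ≤⟨ ℕₚ.+-monoʳ-≤ (l ^ suc l) (ℕₚ.*-monoˡ-≤ (l ^ l) (ℕₚ.n≤1+n l)) ⟩
    l ^ suc l + suc l * l ^ l      ≤⟨ bernoulli l l ⟩
    suc l ^ suc l                  ∎
    where open ℕₚ.≤-Reasoning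

  ^-distribʳ-* : ∀ m n s → (m * n) ^ s ≡ m ^ s * n ^ s
  ^-distribʳ-* m n zero    = refl
  ^-distribʳ-* m n (suc s) = trans (cong (m * n *_) (^-distribʳ-* m n s))
    (solve 4 (λ m n x y → m :* n :* (x :* y) := m :* x :* (n :* y)) refl m n (m ^ s) (n ^ s))
    where open +-*-Solver

  -- This is `(1 - 1/L) ^ c ≤ 2 ^ (-s)`: among the `c` factors there are `s` groups of `L`, each
  -- worth at most one half, and the `d` leftover factors are at most 1.
  2^s*l^c≤L^c : ∀ l s c → suc l * s ≤ c → 2 ^ s * l ^ c ≤ suc l ^ c
  2^s*l^c≤L^c l s c Ls≤c = begin
    2 ^ s * l ^ c                          ≡⟨ cong (λ c → 2 ^ s * l ^ c) (ℕₚ.m+[n∸m]≡n Ls≤c) ⟨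
    2 ^ s * l ^ (suc l * s + d)            ≡⟨ cong (2 ^ s *_) (split l) ⟩
    2 ^ s * ((l ^ suc l) ^ s * l ^ d)      ≡⟨ ℕₚ.*-assoc (2 ^ s) _ _ ⟨
    2 ^ s * (l ^ suc l) ^ s * l ^ d        ≡⟨ cong (_* l ^ d) (^-distribʳ-* 2 (l ^ suc l) s) ⟨
    (2 * l ^ suc l) ^ s * l ^ d            ≤⟨ ℕₚ.*-mono-≤ (ℕₚ.^-monoˡ-≤ s (2*l^L≤L^L l)) (ℕₚ.^-monoˡ-≤ d (ℕₚ.n≤1+n l)) ⟩
    (suc l ^ suc l) ^ s * suc l ^ d        ≡⟨ split (suc l) ⟨
    suc l ^ (suc l * s + d)                ≡⟨ cong (suc l ^_) (ℕₚ.m+[n∸m]≡n Ls≤c) ⟩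
    suc l ^ c                              ∎
    where
    open ℕₚ.≤-Reasoning
    d : ℕ
    d = c ∸ suc l * s
    split : ∀ x → x ^ (suc l * s + d) ≡ (x ^ suc l) ^ s * x ^ d
    split x = trans (ℕₚ.^-distribˡ-+-* x (suc l * s) d) (cong (_* x ^ d) (sym (ℕₚ.^-*-assoc x (suc l) s)))

  -- The avoiding fraction is at most `(l / L) ^ c`, hence at most `2 ^ (-s)`. Without division,
  -- both bounds are multiplied together and `l ^ c` is cancelled.
  avoiding-rare : ∀ {B} l .{{_ : NonZero l}} s (y : Fin B → Fin (suc l) → ℕ) → (∀ β p → y β p ≤ 1) →
    suc l * s ≤ ∑∑ y → 2 ^ s * ∑ (λ b → isZero (∑ λ β → y β (finToFun b β))) ≤ suc l ^ B
  avoiding-rare {B} l s y y≤1 Ls≤c = ℕₚ.*-cancelˡ-≤ (l ^ c) {{ℕₚ.m^n≢0 l c}} (begin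
    l ^ c * (2 ^ s * A)      ≡⟨ solve 3 (λ x y z → x :* (y :* z) := z :* (y :* x)) refl (l ^ c) (2 ^ s) A ⟩
    A * (2 ^ s * l ^ c)      ≤⟨ ℕₚ.*-monoʳ-≤ A (2^s*l^c≤L^c l s c Ls≤c) ⟩
    A * suc l ^ c            ≤⟨ avoiding-choices l y y≤1 ⟩
    l ^ c * suc l ^ B        ∎)
    where
    open ℕₚ.≤-Reasoning
    open +-*-Solver
    c A : ℕ
    c = ∑∑ y
    A = ∑ (λ b → isZero (∑ λ β → y β (finToFun b β)))

  -- Small sets: comparing the total weight with the heaviest class.

  class≡0⇒y*wt≡0 : ∀ {B L κ} (cls : Fin B → Fin κ) (wt : Fin B → ℕ) (y : Fin B → Fin L → ℕ) {β} →
    ∑∑ (λ β′ p → y β′ p * (wt β′ * δ (cls β′) (cls β))) ≡ 0 → ∀ p → y β p * wt β ≡ 0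
  class≡0⇒y*wt≡0 cls wt y {β} ∑∑≡0 p = ℕₚ.n≤0⇒n≡0 (begin
    y β p * wt β                           ≡⟨ cong (y β p *_) (ℕₚ.*-identityʳ (wt β)) ⟨
    y β p * (wt β * 1)                     ≡⟨ cong (λ z → y β p * (wt β * z)) (δ-refl (cls β)) ⟨
    y β p * (wt β * δ (cls β) (cls β))     ≤⟨ term≤∑∑ (λ β′ p′ → y β′ p′ * (wt β′ * δ (cls β′) (cls β))) β p ⟩
    ∑∑ (λ β′ p′ → y β′ p′ * (wt β′ * δ (cls β′) (cls β)))  ≡⟨ ∑∑≡0 ⟩
    0                                      ∎)
    where open ℕₚ.≤-Reasoning

  -- The heaviest class met by y dominates all lighter ones, whose weights are
  -- smaller by a factor q.
  heaviest-class-dominates : ∀ {B L κ} q .{{_ : NonZero q}}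
    (cls : Fin B → Fin κ) (wt : Fin B → ℕ) (ω : Fin κ → ℕ) →
    (∀ β → wt β ≡ 0 ⊎ wt β ≡ ω (cls β)) →
    (∀ {i j} → toℕ i < toℕ j → q * ω j ≤ ω i) →
    (y : Fin B → Fin L → ℕ) → L * ∑∑ y ≤ q →
    L * ∑∑ (λ β p → y β p * wt β) ≤ ⨆ (λ j → suc L * ∑∑ (λ β p → y β p * (wt β * δ (cls β) j)))
  heaviest-class-dominates {B} {L} {κ} q cls wt ω wt-ω decay y Lc≤q
    with least-counterexample (λ j → ∑∑ (λ β p → y β p * (wt β * δ (cls β) j)) ℕₚ.≟ 0)
  -- No class contributes, so everything that `y` selects has weight 0 and the left side vanishes.
  ... | inj₁ all≡0 = subst (_≤ ⨆ x) (sym (trans (cong (L *_) (∑∑≡0 λ β p → class≡0⇒y*wt≡0 cls wt y (all≡0 (cls β)) p)) (ℕₚ.*-zeroʳ L))) z≤n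
    where
    x : Fin κ → ℕ
    x j = suc L * ∑∑ (λ β p → y β p * (wt β * δ (cls β) j))
  -- By `decay`, this first class `j` of nonzero weight is the heaviest one met.
  ... | inj₂ (j , xⱼ≢0 , below) = ℕₚ.≤-trans (ℕₚ.*-cancelˡ-≤ q dominated) (≤⨆ (λ j → suc L * X j) j)
    where
    open ℕₚ.≤-Reasoning
    X : Fin κ → ℕ
    X j = ∑∑ (λ β p → y β p * (wt β * δ (cls β) j))
    -- Classes before `j` contribute nothing, class `j` is counted exactly by the first summand, and
    -- in later classes the factor `q` is absorbed by `decay`.
    pointwise : ∀ β p → q * (y β p * wt β) ≤ q * (y β p * (wt β * δ (cls β) j)) + y β p * ω j
    pointwise β p with ℕₚ.<-cmp (toℕ (cls β)) (toℕ j)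
    ... | tri< clsβ<j _ _ = subst (_≤ q * (y β p * (wt β * δ (cls β) j)) + y β p * ω j)
      (sym (trans (cong (q *_) (class≡0⇒y*wt≡0 cls wt y (below (cls β) clsβ<j) p)) (ℕₚ.*-zeroʳ q))) z≤n
    ... | tri≈ _ clsβ≡j _ = begin
      q * (y β p * wt β)                                  ≡⟨ cong (λ z → q * (y β p * z)) (ℕₚ.*-identityʳ (wt β)) ⟨
      q * (y β p * (wt β * 1))                            ≡⟨ cong (λ z → q * (y β p * (wt β * z))) (δ-refl j) ⟨
      q * (y β p * (wt β * δ j j))                        ≡⟨ cong (λ i → q * (y β p * (wt β * δ i j))) (Finₚ.toℕ-injective clsβ≡j) ⟨
      q * (y β p * (wt β * δ (cls β) j))                  ≤⟨ ℕₚ.m≤m+n _ _ ⟩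
      q * (y β p * (wt β * δ (cls β) j)) + y β p * ω j    ∎
    ... | tri> _ _ j<clsβ = begin
      q * (y β p * wt β)                                  ≡⟨ solve 3 (λ q y w → q :* (y :* w) := y :* (q :* w)) refl q (y β p) (wt β) ⟩
      y β p * (q * wt β)                                  ≤⟨ ℕₚ.*-monoʳ-≤ (y β p) (ℕₚ.≤-trans (ℕₚ.*-monoʳ-≤ q (wt≤ω β)) (decay j<clsβ)) ⟩
      y β p * ω j                                         ≤⟨ ℕₚ.m≤n+m _ _ ⟩
      q * (y β p * (wt β * δ (cls β) j)) + y β p * ω j    ∎
      where
      open +-*-Solver
      wt≤ω : ∀ β → wt β ≤ ω (cls β)
      wt≤ω β with wt-ω β
      ... | inj₁ wtβ≡0 = subst (_≤ ω (cls β)) (sym wtβ≡0) z≤n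
      ... | inj₂ wtβ≡ω = ℕₚ.≤-reflexive wtβ≡ω
    -- A single selected element of a live block in class `j` already weighs `ω j`.
    ωⱼ≤Xⱼ : ω j ≤ X j
    ωⱼ≤Xⱼ with ∑∑≢0⇒∃≢0 (λ β p → y β p * (wt β * δ (cls β) j)) xⱼ≢0
    ... | β , p , term≢0 = begin
      ω j                             ≡⟨ cong ω (δ≢0⇒≡ (cls β) j δ≢0) ⟨
      ω (cls β)                       ≡⟨ wtβ≡ω ⟨
      wt β                            ≤⟨ ℕₚ.m≤m*n (wt β) (y β p * δ (cls β) j) {{ℕ.≢-nonZero yδ≢0}} ⟩
      wt β * (y β p * δ (cls β) j)    ≡⟨ solve 3 (λ w y d → w :* (y :* d) := y :* (w :* d)) refl (wt β) (y β p) (δ (cls β) j) ⟩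
      y β p * (wt β * δ (cls β) j)    ≤⟨ term≤∑∑ (λ β p → y β p * (wt β * δ (cls β) j)) β p ⟩
      X j                             ∎
      where
      open +-*-Solver
      y≢0 : y β p ≢ 0
      y≢0 y≡0 = term≢0 (cong (_* (wt β * δ (cls β) j)) y≡0)
      wδ≢0 : wt β * δ (cls β) j ≢ 0
      wδ≢0 wδ≡0 = term≢0 (trans (cong (y β p *_) wδ≡0) (ℕₚ.*-zeroʳ (y β p)))
      δ≢0 : δ (cls β) j ≢ 0
      δ≢0 δ≡0 = wδ≢0 (trans (cong (wt β *_) δ≡0) (ℕₚ.*-zeroʳ (wt β)))
      yδ≢0 : y β p * δ (cls β) j ≢ 0
      yδ≢0 yδ≡0 with ℕₚ.m*n≡0⇒m≡0∨n≡0 (y β p) yδ≡0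
      ... | inj₁ y≡0 = y≢0 y≡0
      ... | inj₂ δ≡0 = δ≢0 δ≡0
      wtβ≡ω : wt β ≡ ω (cls β)
      wtβ≡ω with wt-ω β
      ... | inj₁ wtβ≡0 = ⊥-elim (wδ≢0 (cong (_* δ (cls β) j) wtβ≡0))
      ... | inj₂ eq    = eq
    -- Summing `pointwise` leaves the excess `L * ∑∑ y * ω j`, at most `q * X j`; this is paid for
    -- by the step from `L` to `suc L`.
    dominated : q * (L * ∑∑ (λ β p → y β p * wt β)) ≤ q * (suc L * X j)
    dominated = begin
      q * (L * x)
        ≡⟨ solve 3 (λ q l x → q :* (l :* x) := l :* (q :* x)) refl q L x ⟩
      L * (q * x)
        ≡⟨ cong (L *_) (*-distribˡ-∑∑ q (λ β p → y β p * wt β)) ⟩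
      L * ∑∑ (λ β p → q * (y β p * wt β))
        ≤⟨ ℕₚ.*-monoʳ-≤ L (∑∑-mono-≤ pointwise) ⟩
      L * ∑∑ (λ β p → q * (y β p * (wt β * δ (cls β) j)) + y β p * ω j)
        ≡⟨ cong (L *_) (∑∑-+ (λ β p → q * (y β p * (wt β * δ (cls β) j))) (λ β p → y β p * ω j)) ⟩
      L * (∑∑ (λ β p → q * (y β p * (wt β * δ (cls β) j))) + ∑∑ (λ β p → y β p * ω j))
        ≡⟨ cong (L *_) (cong₂ _+_ (*-distribˡ-∑∑ q (λ β p → y β p * (wt β * δ (cls β) j))) (*-distribʳ-∑∑ (ω j) y)) ⟨
      L * (q * X j + ∑∑ y * ω j)
        ≡⟨ solve 5 (λ l q x c w → l :* (q :* x :+ c :* w) := q :* (l :* x) :+ (l :* c) :* w) refl L q (X j) (∑∑ y) (ω j) ⟩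
      q * (L * X j) + L * ∑∑ y * ω j
        ≤⟨ ℕₚ.+-monoʳ-≤ (q * (L * X j)) (ℕₚ.*-mono-≤ Lc≤q ωⱼ≤Xⱼ) ⟩
      q * (L * X j) + q * X j
        ≡⟨ solve 3 (λ q l x → q :* (l :* x) :+ q :* x := q :* ((con 1 :+ l) :* x)) refl q L (X j) ⟩
      q * (suc L * X j) ∎
      where
      open +-*-Solver
      x : ℕ
      x = ∑∑ (λ β p → y β p * wt β)

-- Layout of the ground set, and weights of the blocks.

extend : ∀ {a} {A : Set a} {B L} r → (Fin B → Fin L → A) → A → Fin (B ℕ.* L ℕ.+ r) → A
extend {B = B} {L} r f x v = [ (λ u → f (quotient L u) (remainder {B} L u)) , const x ]′ (splitAt (B ℕ.* L) v)

cell : ∀ {B L} r → Fin B → Fin L → Fin (B ℕ.* L ℕ.+ r)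
cell r β p = combine β p ↑ˡ r

extend-cell : ∀ {a} {A : Set a} {B L} r (f : Fin B → Fin L → A) x β p → extend r f x (cell r β p) ≡ f β p
extend-cell {B = B} {L} r f x β p = trans
  (cong [ _ , const x ]′ (Finₚ.splitAt-↑ˡ (B ℕ.* L) (combine β p) r))
  (cong₂ f (quotient-combine β p) (remainder-combine β p))

extend-↑ʳ : ∀ {a} {A : Set a} {B L} r (f : Fin B → Fin L → A) x i → extend {B = B} {L} r f x (B ℕ.* L ↑ʳ i) ≡ x
extend-↑ʳ {B = B} {L} r f x i = cong [ _ , const x ]′ (Finₚ.splitAt-↑ʳ (B ℕ.* L) r i)

χ : ∀ {n} → Subset n → Fin n → ℕ
χ X v = if lookup X v then 1 else 0

χ≤1 : ∀ {n} (X : Subset n) v → χ X v ℕ.≤ 1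
χ≤1 X v with lookup X v
... | true  = ℕₚ.≤-refl
... | false = z≤n

∑-extend : ∀ {B L} r (X : Subset (B ℕ.* L ℕ.+ r)) (f : Fin B → Fin L → ℕ) →
  ∑ (λ v → χ X v ℕ.* extend r f 0 v) ≡ ∑∑ (λ β p → χ X (cell {B} {L} r β p) ℕ.* f β p)
∑-extend {B} {L} r X f = begin
  ∑ (λ v → χ X v ℕ.* extend r f 0 v)
    ≡⟨ ∑-↑ (B ℕ.* L) r _ ⟩
  ∑ (λ u → χ X (u ↑ˡ r) ℕ.* extend r f 0 (u ↑ˡ r)) ℕ.+ ∑ (λ i → χ X (B ℕ.* L ↑ʳ i) ℕ.* extend r f 0 (B ℕ.* L ↑ʳ i))
    ≡⟨ cong₂ ℕ._+_ (∑-combine B L (λ u → χ X (u ↑ˡ r) ℕ.* extend r f 0 (u ↑ˡ r)))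
         (trans (∑-cong λ i → trans (cong (χ X (B ℕ.* L ↑ʳ i) ℕ.*_) (extend-↑ʳ r f 0 i)) (ℕₚ.*-zeroʳ (χ X (B ℕ.* L ↑ʳ i)))) (∑-zero r)) ⟩
  ∑∑ (λ β p → χ X (cell {B} {L} r β p) ℕ.* extend r f 0 (cell {B} {L} r β p)) ℕ.+ 0
    ≡⟨ ℕₚ.+-identityʳ _ ⟩
  ∑∑ (λ β p → χ X (cell {B} {L} r β p) ℕ.* extend r f 0 (cell {B} {L} r β p))
    ≡⟨ ∑∑-cong (λ β p → cong (χ X (cell {B} {L} r β p) ℕ.*_) (extend-cell r f 0 β p)) ⟩
  ∑∑ (λ β p → χ X (cell {B} {L} r β p) ℕ.* f β p) ∎
  where open ≡-Reasoning

δ-sym : ∀ {n} (i j : Fin n) → δ i j ≡ δ j i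
δ-sym i j with i Finₚ.≟ j | j Finₚ.≟ i
... | yes _   | yes _   = refl
... | no  _   | no  _   = refl
... | yes i≡j | no  j≢i = ⊥-elim (j≢i (sym i≡j))
... | no  i≢j | yes j≡i = ⊥-elim (i≢j (sym j≡i))

∑-δ : ∀ {n} (i : Fin n) → ∑ (δ i) ≡ 1
∑-δ i = trans (∑-cong λ j → trans (δ-sym i j) (sym (ℕₚ.+-identityʳ (δ j i)))) (∑-*-δ (λ _ → 1) i)

-- The maximum of hidden and base value, as a function of the number of traps hit: a single trap
-- makes the hidden function negligible against the base.
unlessTrapped : ℕ → ℕ → ℕ → ℕ
unlessTrapped zero    h g = h ℕ.⊔ g
unlessTrapped (suc _) h g = g

-- Every class gets P blocks, so that blocks are pairs (class, index); those of class i
-- beyond the first q ^ i are dummies.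
module GeometricWeights (κ′ q : ℕ) .{{_ : NonZero q}} where

  P : ℕ
  P = q ℕ.^ κ′

  Block : Set
  Block = Fin (suc κ′ ℕ.* P)

  cls : Block → Fin (suc κ′)
  cls = quotient P

  -- The proportions `q ^ (-i)`, scaled by `P` to become integers.
  ω : Fin (suc κ′) → ℕ
  ω i = q ℕ.^ (κ′ ℕ.∸ toℕ i)

  live : Fin (suc κ′) → Fin P → ℕ
  live i ρ = if toℕ ρ ℕ.<ᵇ q ℕ.^ toℕ i then 1 else 0

  wt : Block → ℕ
  wt β = ω (cls β) ℕ.* live (cls β) (remainder {suc κ′} P β)

  wt-ω : ∀ β → wt β ≡ 0 ⊎ wt β ≡ ω (cls β)
  wt-ω β with toℕ (remainder {suc κ′} P β) ℕ.<ᵇ q ℕ.^ toℕ (cls β)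
  ... | true  = inj₂ (ℕₚ.*-identityʳ (ω (cls β)))
  ... | false = inj₁ (ℕₚ.*-zeroʳ (ω (cls β)))

  decay : ∀ {i j} → toℕ i ℕ.< toℕ j → q ℕ.* ω j ℕ.≤ ω i
  decay {i} {j} i<j = ℕₚ.^-monoʳ-≤ q (begin
    suc (κ′ ℕ.∸ toℕ j)   ≡⟨ ℕₚ.+-∸-assoc 1 (ℕ.s≤s⁻¹ (Finₚ.toℕ<n j)) ⟨
    suc κ′ ℕ.∸ toℕ j     ≤⟨ ℕₚ.∸-monoʳ-≤ (suc κ′) i<j ⟩
    κ′ ℕ.∸ toℕ i         ∎)
    where open ℕₚ.≤-Reasoning

  ω*q^i≡P : ∀ i → ω i ℕ.* q ℕ.^ toℕ i ≡ P
  ω*q^i≡P i = trans (sym (ℕₚ.^-distribˡ-+-* q (κ′ ℕ.∸ toℕ i) (toℕ i)))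
    (cong (q ℕ.^_) (ℕₚ.m∸n+n≡m (ℕ.s≤s⁻¹ (Finₚ.toℕ<n i))))

  -- Class `j` has `q ^ j` live blocks, each of weight `q ^ (κ′ - j)`.
  ∑-class : ∀ j → ∑ (λ β → wt β ℕ.* δ (cls β) j) ≡ P
  ∑-class j = begin
    ∑ (λ β → wt β ℕ.* δ (cls β) j)
      ≡⟨ ∑-combine (suc κ′) P (λ β → wt β ℕ.* δ (cls β) j) ⟩
    ∑∑ {suc κ′} {P} (λ i ρ → wt (combine i ρ) ℕ.* δ (cls (combine i ρ)) j)
      ≡⟨ ∑∑-cong {suc κ′} {P} (λ i ρ → cong₂ (λ i ρ → ω i ℕ.* live i ρ ℕ.* δ i j) (quotient-combine i ρ) (remainder-combine i ρ)) ⟩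
    ∑∑ {suc κ′} {P} (λ i ρ → ω i ℕ.* live i ρ ℕ.* δ i j)
      ≡⟨ ∑-cong (λ i → trans (sym (*-distribʳ-∑ (δ i j) (λ ρ → ω i ℕ.* live i ρ)))
           (cong (ℕ._* δ i j) (sym (*-distribˡ-∑ (ω i) (live i))))) ⟩
    ∑ {suc κ′} (λ i → ω i ℕ.* ∑ (live i) ℕ.* δ i j)
      ≡⟨ ∑-*-δ (λ i → ω i ℕ.* ∑ (live i)) j ⟩
    ω j ℕ.* ∑ (live j)
      ≡⟨ cong (ω j ℕ.*_) (∑-<ᵇ P (q ℕ.^ toℕ j) (ℕₚ.^-monoʳ-≤ q (ℕ.s≤s⁻¹ (Finₚ.toℕ<n j)))) ⟩
    ω j ℕ.* q ℕ.^ toℕ j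
      ≡⟨ ω*q^i≡P j ⟩
    P ∎
    where open ≡-Reasoning

-- Growth and crossing points of functions on the natural numbers.

n<2^n : ∀ n → n ℕ.< 2 ℕ.^ n
n<2^n zero    = s≤s z≤n
n<2^n (suc n) = begin-strict
  suc n                      <⟨ s≤s (n<2^n n) ⟩
  1 ℕ.+ 2 ℕ.^ n              ≤⟨ ℕₚ.+-monoˡ-≤ (2 ℕ.^ n) (ℕₚ.m^n>0 2 n) ⟩
  2 ℕ.^ n ℕ.+ 2 ℕ.^ n        ≡⟨ cong (2 ℕ.^ n ℕ.+_) (ℕₚ.+-identityʳ (2 ℕ.^ n)) ⟨
  2 ℕ.^ suc n                ∎
  where open ℕₚ.≤-Reasoning

-- Stands in for inverting `φ` at `n`: the search runs down from `N` until `φ` crosses `n`.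
last-below : ∀ (φ : ℕ → ℕ) n N → n ℕ.< φ N → n ℕ.< φ 0 ⊎ ∃[ g ] φ g ℕ.≤ n × n ℕ.< φ (suc g)
last-below φ n zero    n<φN = inj₁ n<φN
last-below φ n (suc N) n<φN with φ N ℕₚ.≤? n
... | yes φN≤n = inj₂ (N , φN≤n , n<φN)
... | no  φN≰n = last-below φ n N (ℕₚ.≰⇒> φN≰n)

-- Arithmetic in an ordered field.

module OrderedField {a ℓ} (R : ArchimedeanOrderedField a ℓ) where
  open ArchimedeanOrderedField R
  open CommutativeRing commutativeRing public using
    ( +-assoc; +-comm; +-identityˡ; +-identityʳ; -‿inverseˡ; -‿inverseʳ
    ; *-assoc; *-comm; *-identityˡ; *-identityʳ; distribˡ; distribʳ; zeroˡ; zeroʳ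
    ; commutativeSemiring; semiring; ring)
  open RingProperties ring public using (-‿distribˡ-*; -‿involutive)
  open Sum semiring public using (sum-cong-≗; ∑-distrib-+; *-distribˡ-sum; *-distribʳ-sum)
  open IsDecTotalOrder isDecTotalOrder public using (_≟_)
    renaming (refl to ≤-refl; reflexive to ≤-reflexive; trans to ≤-trans; antisym to ≤-antisym; total to ≤-total)
  open Solver commutativeSemiring public using (solve; _:=_; _:+_; _:*_)

  poset : Poset a a ℓ
  poset = record { isPartialOrder = IsDecTotalOrder.isPartialOrder isDecTotalOrder }

  module ≤-Reasoning = PartialOrderReasoning poset

  <⇒≱ : ∀ {x y} → x < y → ¬ y ≤ x
  <⇒≱ (x≤y , x≢y) y≤x = x≢y (≤-antisym x≤y y≤x)

  ≰⇒> : ∀ {x y} → ¬ x ≤ y → y < x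
  ≰⇒> {x} {y} x≰y with ≤-total x y
  ... | inj₁ x≤y = ⊥-elim (x≰y x≤y)
  ... | inj₂ y≤x = y≤x , λ y≡x → x≰y (≤-reflexive (sym y≡x))

  <-≤-trans : ∀ {x y z} → x < y → y ≤ z → x < z
  <-≤-trans x<y@(x≤y , _) y≤z = ≤-trans x≤y y≤z , λ x≡z → <⇒≱ x<y (subst (_ ≤_) (sym x≡z) y≤z)

  +-mono-≤ : ∀ {x y u v} → x ≤ y → u ≤ v → x + u ≤ y + v
  +-mono-≤ {x} {y} {u} {v} x≤y u≤v = begin
    x + u ≤⟨ +-monoʳ-≤ x u≤v ⟩
    x + v ≡⟨ +-comm x v ⟩
    v + x ≤⟨ +-monoʳ-≤ v x≤y ⟩
    v + y ≡⟨ +-comm v y ⟩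
    y + v ∎
    where open ≤-Reasoning

  +-monoˡ-≤ : ∀ z {x y} → x ≤ y → x + z ≤ y + z
  +-monoˡ-≤ z x≤y = +-mono-≤ x≤y ≤-refl

  +-cancelˡ-≤ : ∀ z {x y} → z + x ≤ z + y → x ≤ y
  +-cancelˡ-≤ z {x} {y} z+x≤z+y = begin
    x               ≡⟨ cancel x ⟩
    - z + (z + x)   ≤⟨ +-monoʳ-≤ (- z) z+x≤z+y ⟩
    - z + (z + y)   ≡⟨ cancel y ⟨
    y               ∎
    where
    open ≤-Reasoning
    cancel : ∀ w → w ≡ - z + (z + w)
    cancel w = sym (trans (sym (+-assoc (- z) z w)) (trans (cong (_+ w) (-‿inverseˡ z)) (+-identityˡ w)))

  x+y-x≡y : ∀ x y → x + (y - x) ≡ y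
  x+y-x≡y x y = begin
    x + (y + (- x)) ≡⟨ cong (x +_) (+-comm y (- x)) ⟩
    x + (- x + y)   ≡⟨ +-assoc x (- x) y ⟨
    (x + - x) + y   ≡⟨ cong (_+ y) (-‿inverseʳ x) ⟩
    0# + y          ≡⟨ +-identityˡ y ⟩
    y               ∎
    where open ≡-Reasoning

  x≤y⇒0≤y-x : ∀ {x y} → x ≤ y → 0# ≤ y - x
  x≤y⇒0≤y-x {x} {y} x≤y = +-cancelˡ-≤ x (begin
    x + 0#       ≡⟨ +-identityʳ x ⟩
    x            ≤⟨ x≤y ⟩
    y            ≡⟨ x+y-x≡y x y ⟨
    x + (y - x)  ∎)
    where open ≤-Reasoning

  x-y≤z⇒x≤z+y : ∀ {x y z} → x ≤ z + y → x - y ≤ z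
  x-y≤z⇒x≤z+y {x} {y} {z} x≤z+y = +-cancelˡ-≤ y (begin
    y + (x - y) ≡⟨ x+y-x≡y y x ⟩
    x           ≤⟨ x≤z+y ⟩
    z + y       ≡⟨ +-comm z y ⟩
    y + z       ∎)
    where open ≤-Reasoning

  *-monoˡ-≤-nonNeg : ∀ {z x y} → 0# ≤ z → x ≤ y → z * x ≤ z * y
  *-monoˡ-≤-nonNeg {z} {x} {y} 0≤z x≤y = begin
    z * x                ≡⟨ +-identityʳ (z * x) ⟨
    z * x + 0#           ≤⟨ +-monoʳ-≤ (z * x) (*-nonNegative 0≤z (x≤y⇒0≤y-x x≤y)) ⟩
    z * x + z * (y - x)  ≡⟨ distribˡ z x (y - x) ⟨
    z * (x + (y - x))    ≡⟨ cong (z *_) (x+y-x≡y x y) ⟩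
    z * y                ∎
    where open ≤-Reasoning

  *-monoʳ-≤-nonNeg : ∀ {z x y} → 0# ≤ z → x ≤ y → x * z ≤ y * z
  *-monoʳ-≤-nonNeg {z} {x} {y} 0≤z x≤y = begin
    x * z ≡⟨ *-comm x z ⟩
    z * x ≤⟨ *-monoˡ-≤-nonNeg 0≤z x≤y ⟩
    z * y ≡⟨ *-comm z y ⟩
    y * z ∎
    where open ≤-Reasoning

  *-mono-≤-nonNeg : ∀ {w x y z} → 0# ≤ w → 0# ≤ z → w ≤ x → y ≤ z → w * y ≤ x * z
  *-mono-≤-nonNeg 0≤w 0≤z w≤x y≤z = ≤-trans (*-monoˡ-≤-nonNeg 0≤w y≤z) (*-monoʳ-≤-nonNeg 0≤z w≤x)

  neg-mono-≤ : ∀ {x} → x ≤ 0# → 0# ≤ - x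
  neg-mono-≤ {x} x≤0 = subst (0# ≤_) (+-identityˡ (- x)) (x≤y⇒0≤y-x x≤0)

  0≤1 : 0# ≤ 1#
  0≤1 with ≤-total 0# 1#
  ... | inj₁ 0≤1 = 0≤1
  -- If `1#` were nonpositive, then `- 1#` would be nonnegative, and so would its square, which is
  -- `1#`.
  ... | inj₂ 1≤0 = subst (0# ≤_) -1*-1≡1 (*-nonNegative 0≤-1 0≤-1)
    where
    0≤-1 : 0# ≤ - 1#
    0≤-1 = neg-mono-≤ 1≤0
    -1*-1≡1 : - 1# * - 1# ≡ 1#
    -1*-1≡1 = trans (sym (-‿distribˡ-* 1# (- 1#))) (trans (cong -_ (*-identityˡ (- 1#))) (-‿involutive 1#))

  0<1 : 0# < 1#
  0<1 = 0≤1 , 0≢1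

  0<x⇒x≢0 : ∀ {x} → 0# < x → x ≢ 0#
  0<x⇒x≢0 (_ , 0≢x) x≡0 = 0≢x (sym x≡0)

  0<⇒0≤⁻¹ : ∀ {x} → 0# < x → 0# ≤ x ⁻¹
  0<⇒0≤⁻¹ {x} 0<x@(0≤x , _) with ≤-total 0# (x ⁻¹)
  ... | inj₁ 0≤x⁻¹ = 0≤x⁻¹
  ... | inj₂ x⁻¹≤0 = ⊥-elim (<⇒≱ 0<1 (begin
    1#       ≡⟨ *-inverseʳ x (0<x⇒x≢0 0<x) ⟨
    x * x ⁻¹ ≤⟨ *-monoˡ-≤-nonNeg 0≤x x⁻¹≤0 ⟩
    x * 0#   ≡⟨ zeroʳ x ⟩
    0#       ∎))
    where open ≤-Reasoning

  *-cancelˡ-≤-pos : ∀ {z x y} → 0# < z → z * x ≤ z * y → x ≤ y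
  *-cancelˡ-≤-pos {z} {x} {y} 0<z zx≤zy = begin
    x               ≡⟨ cancel x ⟩
    z ⁻¹ * (z * x)  ≤⟨ *-monoˡ-≤-nonNeg (0<⇒0≤⁻¹ 0<z) zx≤zy ⟩
    z ⁻¹ * (z * y)  ≡⟨ cancel y ⟨
    y               ∎
    where
    open ≤-Reasoning
    cancel : ∀ w → w ≡ z ⁻¹ * (z * w)
    cancel w = sym (trans (sym (*-assoc (z ⁻¹) z w))
      (trans (cong (_* w) (trans (*-comm (z ⁻¹) z) (*-inverseʳ z (0<x⇒x≢0 0<z)))) (*-identityˡ w)))

  0<⇒0<* : ∀ {x y} → 0# < x → 0# < y → 0# < x * y
  0<⇒0<* {x} {y} 0<x@(0≤x , _) 0<y@(0≤y , _) = *-nonNegative 0≤x 0≤y , λ 0≡xy →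
    <⇒≱ 0<y (*-cancelˡ-≤-pos 0<x (≤-reflexive (trans (sym 0≡xy) (sym (zeroʳ x)))))

  x≤y+x : ∀ {x y} → 0# ≤ y → x ≤ y + x
  x≤y+x {x} {y} 0≤y = subst (_≤ y + x) (+-identityˡ x) (+-monoˡ-≤ x 0≤y)

  x≤x+y : ∀ {x y} → 0# ≤ y → x ≤ x + y
  x≤x+y {x} {y} 0≤y = subst (_≤ x + y) (+-identityʳ x) (+-monoʳ-≤ x 0≤y)

  0≤x+y : ∀ {x y} → 0# ≤ x → 0# ≤ y → 0# ≤ x + y
  0≤x+y 0≤x 0≤y = ≤-trans 0≤y (x≤y+x 0≤x)

  fromℕ-homo-+ : ∀ m n → fromℕ (m ℕ.+ n) ≡ fromℕ m + fromℕ n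
  fromℕ-homo-+ = Mult.×-homo-+ semiring 1#

  fromℕ-homo-* : ∀ m n → fromℕ (m ℕ.* n) ≡ fromℕ m * fromℕ n
  fromℕ-homo-* = Mult.×1-homo-* semiring

  0≤fromℕ : ∀ n → 0# ≤ fromℕ n
  0≤fromℕ zero    = ≤-refl
  0≤fromℕ (suc n) = 0≤x+y 0≤1 (0≤fromℕ n)

  fromℕ-mono-≤ : ∀ {m n} → m ℕ.≤ n → fromℕ m ≤ fromℕ n
  fromℕ-mono-≤ {n = n} ℕ.z≤n = 0≤fromℕ n
  fromℕ-mono-≤ (ℕ.s≤s m≤n) = +-monoʳ-≤ 1# (fromℕ-mono-≤ m≤n)

  0<fromℕ : ∀ {n} → 0 ℕ.< n → 0# < fromℕ n
  0<fromℕ {suc n} (ℕ.s≤s _) = <-≤-trans 0<1 (x≤x+y (0≤fromℕ n))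

  sum-mono-≤ : ∀ {n} {f g : Fin n → Carrier} → (∀ i → f i ≤ g i) → sum f ≤ sum g
  sum-mono-≤ {zero}  f≤g = ≤-refl
  sum-mono-≤ {suc n} f≤g = +-mono-≤ (f≤g zero) (sum-mono-≤ (f≤g ∘ suc))

  sum-const : ∀ n x → sum {n} (λ _ → x) ≡ fromℕ n * x
  sum-const zero    x = sym (zeroˡ x)
  sum-const (suc n) x = begin
    x + sum {n} (λ _ → x)   ≡⟨ cong₂ _+_ (sym (*-identityˡ x)) (sum-const n x) ⟩
    1# * x + fromℕ n * x    ≡⟨ distribʳ x 1# (fromℕ n) ⟨
    (1# + fromℕ n) * x      ∎
    where open ≡-Reasoning

-- Expectations over the runs of a randomized algorithm.

module _ {a ℓ} (R : ArchimedeanOrderedField a ℓ) where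
  open ArchimedeanOrderedField R
  open XOS R
  open OrderedField R

  mix : Carrier → Carrier → Carrier → Carrier
  mix p x y = p * x + (1# - p) * y

  mix-mono : ∀ {p x x′ y y′} → 0# ≤ p → p ≤ 1# → x ≤ x′ → y ≤ y′ → mix p x y ≤ mix p x′ y′
  mix-mono 0≤p p≤1 x≤x′ y≤y′ =
    +-mono-≤ (*-monoˡ-≤-nonNeg 0≤p x≤x′) (*-monoˡ-≤-nonNeg (x≤y⇒0≤y-x p≤1) y≤y′)

  mix-const : ∀ p x → mix p x x ≡ x
  mix-const p x = begin
    p * x + (1# - p) * x  ≡⟨ distribʳ x p (1# - p) ⟨
    (p + (1# - p)) * x    ≡⟨ cong (_* x) (x+y-x≡y p 1#) ⟩
    1# * x                ≡⟨ *-identityˡ x ⟩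
    x                     ∎
    where open ≡-Reasoning

  mix-≤ : ∀ {p x y z} → 0# ≤ p → p ≤ 1# → x ≤ z → y ≤ z → mix p x y ≤ z
  mix-≤ {p} {x} {y} {z} 0≤p p≤1 x≤z y≤z =
    subst (mix p x y ≤_) (mix-const p z) (mix-mono 0≤p p≤1 x≤z y≤z)

  mix-≥ : ∀ {p x y z} → 0# ≤ p → p ≤ 1# → z ≤ x → z ≤ y → z ≤ mix p x y
  mix-≥ {p} {x} {y} {z} 0≤p p≤1 z≤x z≤y =
    subst (_≤ mix p x y) (mix-const p z) (mix-mono 0≤p p≤1 z≤x z≤y)

  -- Lets a bound that is affine in two expectations pass through a coin toss.
  mix-affine : ∀ p u w v x x′ y y′ →
    mix p (u + w * (x + v * x′)) (u + w * (y + v * y′)) ≡ u + w * (mix p x y + v * mix p x′ y′)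
  mix-affine p u w v x x′ y y′ = begin
    mix p (u + w * (x + v * x′)) (u + w * (y + v * y′))
      ≡⟨ solve 9 (λ p q u w v x x′ y y′ →
           p :* (u :+ w :* (x :+ v :* x′)) :+ q :* (u :+ w :* (y :+ v :* y′)) :=
           (p :* u :+ q :* u) :+ w :* ((p :* x :+ q :* y) :+ v :* (p :* x′ :+ q :* y′)))
           refl p (1# - p) u w v x x′ y y′ ⟩
    mix p u u + w * (mix p x y + v * mix p x′ y′)
      ≡⟨ cong (_+ w * (mix p x y + v * mix p x′ y′)) (mix-const p u) ⟩
    u + w * (mix p x y + v * mix p x′ y′)
      ∎
    where open ≡-Reasoning

  sum-mix : ∀ {m} p (x y : Fin m → Carrier) → sum (λ i → mix p (x i) (y i)) ≡ mix p (sum x) (sum y)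
  sum-mix p x y = trans (∑-distrib-+ (λ i → p * x i) (λ i → (1# - p) * y i))
    (cong₂ _+_ (sym (*-distribˡ-sum p x)) (sym (*-distribˡ-sum (1# - p) y)))

  module _ {n : ℕ} (f : SetFunction n) where

    𝔼-suc : ∀ A (φ : Subset n → ℕ → Carrier) →
      𝔼 f A (λ X q → 1# + φ X q) ≡ 1# + 𝔼 f A φ
    𝔼-suc (output X)       φ = refl
    𝔼-suc (query X κ)      φ = 𝔼-suc (κ (f X)) (λ Y q → φ Y (suc q))
    𝔼-suc (toss p _ _ A B) φ = begin
      mix p (𝔼 f A (λ X q → 1# + φ X q)) (𝔼 f B (λ X q → 1# + φ X q))
        ≡⟨ cong₂ (mix p) (𝔼-suc A φ) (𝔼-suc B φ) ⟩
      mix p (1# + x) (1# + y)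
        ≡⟨ solve 5 (λ p q i x y → p :* (i :+ x) :+ q :* (i :+ y) :=
             (p :* i :+ q :* i) :+ (p :* x :+ q :* y)) refl p (1# - p) 1# x y ⟩
      mix p 1# 1# + mix p x y
        ≡⟨ cong (_+ mix p x y) (mix-const p 1#) ⟩
      1# + mix p x y
        ∎
      where
      open ≡-Reasoning
      x y : Carrier
      x = 𝔼 f A φ
      y = 𝔼 f B φ

    expectedCalls-query : ∀ X κ → expectedCalls f (query X κ) ≡ 1# + expectedCalls f (κ (f X))
    expectedCalls-query X κ = 𝔼-suc (κ (f X)) (λ _ q → fromℕ q)

    expectedCalls-≥0 : ∀ A → 0# ≤ expectedCalls f A
    expectedCalls-≥0 (output X)  = ≤-refl
    expectedCalls-≥0 (query X κ) =
      subst (0# ≤_) (sym (expectedCalls-query X κ)) (0≤x+y 0≤1 (expectedCalls-≥0 (κ (f X))))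
    expectedCalls-≥0 (toss p 0≤p p≤1 A B) = mix-≥ 0≤p p≤1 (expectedCalls-≥0 A) (expectedCalls-≥0 B)

    expectedValue-≤ : ∀ {w} → (∀ X → f X ≤ w) → ∀ A → expectedValue f A ≤ w
    expectedValue-≤ f≤w (output X)           = f≤w X
    expectedValue-≤ f≤w (query X κ)          = expectedValue-≤ f≤w (κ (f X))
    expectedValue-≤ f≤w (toss p 0≤p p≤1 A B) = mix-≤ 0≤p p≤1 (expectedValue-≤ f≤w A) (expectedValue-≤ f≤w B)

  -- The probability of making at least one call. It takes no input function, because no answer is
  -- received before the first query.
  callProbability : ∀ {n} → Algorithm n → Carrier
  callProbability (output X)       = 0#
  callProbability (query X κ)      = 1#
  callProbability (toss p _ _ A B) = mix p (callProbability A) (callProbability B)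

  callProbability≤expectedCalls : ∀ {n} (f : SetFunction n) A → callProbability A ≤ expectedCalls f A
  callProbability≤expectedCalls f (output X)  = ≤-refl
  callProbability≤expectedCalls f (query X κ) =
    subst (1# ≤_) (sym (expectedCalls-query f X κ)) (x≤x+y (expectedCalls-≥0 f (κ (f X))))
  callProbability≤expectedCalls f (toss p 0≤p p≤1 A B) =
    mix-mono 0≤p p≤1 (callProbability≤expectedCalls f A) (callProbability≤expectedCalls f B)

  -- Comparing a run on an instance with the run on the base function.

  module _ {n : ℕ} (base : SetFunction n) where

    reveals : SetFunction n → Subset n → Carrier
    reveals f X = if does (f X ≟ base X) then 0# else 1#

    -- The probability that the run of the algorithm against base meets a set on
    -- which f and base differ, as a query or as the output, when the run is
    -- abandoned with probability θ after each query.
    discovery : Carrier → SetFunction n → Algorithm n → Carrier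
    discovery θ f (output X) = reveals f X
    discovery θ f (query X κ) with f X ≟ base X
    ... | yes _ = (1# - θ) * discovery θ f (κ (base X))
    ... | no  _ = 1#
    discovery θ f (toss p _ _ A B) = mix p (discovery θ f A) (discovery θ f B)

    reveals-≥0 : ∀ f X → 0# ≤ reveals f X
    reveals-≥0 f X with f X ≟ base X
    ... | yes _ = ≤-refl
    ... | no  _ = 0≤1

    reveals-≤1 : ∀ f X → reveals f X ≤ 1#
    reveals-≤1 f X with f X ≟ base X
    ... | yes _ = 0≤1
    ... | no  _ = ≤-refl

    module _ {θ : Carrier} (0≤θ : 0# ≤ θ) (θ≤1 : θ ≤ 1#) where

      private
        0≤1-θ : 0# ≤ 1# - θ
        0≤1-θ = x≤y⇒0≤y-x θ≤1

        1-θ≤1 : 1# - θ ≤ 1#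
        1-θ≤1 = x-y≤z⇒x≤z+y (x≤x+y 0≤θ)

      discovery-≥0 : ∀ f A → 0# ≤ discovery θ f A
      discovery-≥0 f (output X) = reveals-≥0 f X
      discovery-≥0 f (query X κ) with f X ≟ base X
      ... | yes _ = *-nonNegative 0≤1-θ (discovery-≥0 f (κ (base X)))
      ... | no  _ = 0≤1
      discovery-≥0 f (toss p 0≤p p≤1 A B) = mix-≥ 0≤p p≤1 (discovery-≥0 f A) (discovery-≥0 f B)

      discovery-≤1 : ∀ f A → discovery θ f A ≤ 1#
      discovery-≤1 f (output X) = reveals-≤1 f X
      discovery-≤1 f (query X κ) with f X ≟ base X
      ... | yes _ = ≤-trans (*-mono-≤-nonNeg 0≤1-θ 0≤1 1-θ≤1 (discovery-≤1 f (κ (base X))))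
        (≤-reflexive (*-identityˡ 1#))
      ... | no  _ = ≤-refl
      discovery-≤1 f (toss p 0≤p p≤1 A B) = mix-≤ 0≤p p≤1 (discovery-≤1 f A) (discovery-≤1 f B)

      discovery-query : ∀ f X κ →
        discovery θ f (query X κ) ≤ reveals f X + (1# - θ) * discovery θ f (κ (base X))
      discovery-query f X κ with f X ≟ base X
      ... | yes _ = ≤-reflexive (sym (+-identityˡ _))
      ... | no  _ = x≤x+y (*-nonNegative 0≤1-θ (discovery-≥0 f (κ (base X))))

      -- The run against `base` asks the same sets for every `b`, so `rare` applies to each of them.
      -- A query adds at most `θ * Γ` and discounts the rest by `1# - θ`; since `Γ` is a fixed point
      -- of this recursion, the depth of the tree does not enter.
      ∑-discovery-≤ : ∀ {Z} (F : Fin Z → SetFunction n) {Γ} → 0# ≤ Γ →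
        (∀ X → sum (λ b → reveals (F b) X) ≤ θ * Γ) →
        ∀ A → sum (λ b → discovery θ (F b) A) ≤ Γ
      ∑-discovery-≤ F {Γ} 0≤Γ rare (output X) = begin
        sum (λ b → reveals (F b) X) ≤⟨ rare X ⟩
        θ * Γ                       ≤⟨ *-monoʳ-≤-nonNeg 0≤Γ θ≤1 ⟩
        1# * Γ                      ≡⟨ *-identityˡ Γ ⟩
        Γ                           ∎
        where open ≤-Reasoning
      ∑-discovery-≤ F {Γ} 0≤Γ rare (query X κ) = begin
        sum (λ b → discovery θ (F b) (query X κ))
          ≤⟨ sum-mono-≤ (λ b → discovery-query (F b) X κ) ⟩
        sum (λ b → reveals (F b) X + (1# - θ) * discovery θ (F b) (κ (base X)))
          ≡⟨ ∑-distrib-+ (λ b → reveals (F b) X) (λ b → (1# - θ) * discovery θ (F b) (κ (base X))) ⟩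
        sum (λ b → reveals (F b) X) + sum (λ b → (1# - θ) * discovery θ (F b) (κ (base X)))
          ≡⟨ cong (sum (λ b → reveals (F b) X) +_) (*-distribˡ-sum (1# - θ) (λ b → discovery θ (F b) (κ (base X)))) ⟨
        sum (λ b → reveals (F b) X) + (1# - θ) * sum (λ b → discovery θ (F b) (κ (base X)))
          ≤⟨ +-mono-≤ (rare X) (*-monoˡ-≤-nonNeg 0≤1-θ (∑-discovery-≤ F 0≤Γ rare (κ (base X)))) ⟩
        mix θ Γ Γ
          ≡⟨ mix-const θ Γ ⟩
        Γ ∎
        where open ≤-Reasoning
      ∑-discovery-≤ F {Γ} 0≤Γ rare (toss p 0≤p p≤1 A B) = begin
        sum (λ b → mix p (discovery θ (F b) A) (discovery θ (F b) B))
          ≡⟨ sum-mix p (λ b → discovery θ (F b) A) (λ b → discovery θ (F b) B) ⟩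
        mix p (sum (λ b → discovery θ (F b) A)) (sum (λ b → discovery θ (F b) B))
          ≤⟨ mix-≤ 0≤p p≤1 (∑-discovery-≤ F 0≤Γ rare A) (∑-discovery-≤ F 0≤Γ rare B) ⟩
        Γ ∎
        where open ≤-Reasoning

      module _ {f : SetFunction n} {u w : Carrier} (0≤u : 0# ≤ u) (0≤w : 0# ≤ w)
               (base≤u : ∀ X → base X ≤ u) (f≤w : ∀ X → f X ≤ w) where

        private
          f≤u+w[1+_] : ∀ {x v} → x ≤ w → 0# ≤ v → x ≤ u + w * (1# + v)
          f≤u+w[1+_] {x} {v} x≤w 0≤v = begin
            x                  ≤⟨ x≤w ⟩
            w                  ≡⟨ *-identityʳ w ⟨
            w * 1#             ≤⟨ *-monoˡ-≤-nonNeg 0≤w (x≤x+y 0≤v) ⟩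
            w * (1# + v)       ≤⟨ x≤y+x 0≤u ⟩
            u + w * (1# + v)   ∎
            where open ≤-Reasoning

          output-≤ : ∀ X {v} → 0# ≤ v → f X ≤ u + w * (reveals f X + v)
          output-≤ X {v} 0≤v with f X ≟ base X
          ... | yes fX≡baseX = ≤-trans (subst (_≤ u) (sym fX≡baseX) (base≤u X))
            (x≤x+y (*-nonNegative 0≤w (0≤x+y ≤-refl 0≤v)))
          ... | no _ = f≤u+w[1+_] (f≤w X) 0≤v

        -- Abandoning the run costs θ per query and loses at most
        -- discovery ≤ 1, which the expected number of calls pays for.
        expectedValue-≤-calls : ∀ A →
          expectedValue f A ≤ u + w * (discovery θ f A + θ * expectedCalls f A)
        expectedValue-≤-calls (output X) = output-≤ X (*-nonNegative 0≤θ ≤-refl)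
        expectedValue-≤-calls (query X κ) with f X ≟ base X
        ... | no _ = f≤u+w[1+_] (expectedValue-≤ f f≤w (κ (f X)))
          (*-nonNegative 0≤θ (expectedCalls-≥0 f (query X κ)))
        ... | yes fX≡baseX = ≤-trans (expectedValue-≤-calls (κ (f X)))
          (+-monoʳ-≤ u (*-monoˡ-≤-nonNeg 0≤w (begin
            discovery θ f A′ + θ * N
              ≡⟨ cong (_+ θ * N) (mix-const θ _) ⟨
            -- The share `θ` of the discovery probability is lost by abandoning; bounded by
            -- `θ * 1#`, it becomes the charge for the call just made.
            mix θ (discovery θ f A′) (discovery θ f A′) + θ * N
              ≤⟨ +-monoˡ-≤ (θ * N) (+-monoˡ-≤ _ (*-monoˡ-≤-nonNeg 0≤θ (discovery-≤1 f A′))) ⟩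
            mix θ 1# (discovery θ f A′) + θ * N
              ≡⟨ solve 5 (λ θ i q d N → (θ :* i :+ q :* d) :+ θ :* N := q :* d :+ θ :* (i :+ N))
                   refl θ 1# (1# - θ) (discovery θ f A′) N ⟩
            (1# - θ) * discovery θ f A′ + θ * (1# + N)
              ≡⟨ cong₂ (λ x y → (1# - θ) * discovery θ f (κ x) + θ * y)
                   fX≡baseX (sym (expectedCalls-query f X κ)) ⟩
            (1# - θ) * discovery θ f (κ (base X)) + θ * expectedCalls f (query X κ)
              ∎)))
          where
          open ≤-Reasoning
          A′ : Algorithm n
          A′ = κ (f X)
          N : Carrier
          N = expectedCalls f A′
        expectedValue-≤-calls (toss p 0≤p p≤1 A B) = ≤-trans
          (mix-mono 0≤p p≤1 (expectedValue-≤-calls A) (expectedValue-≤-calls B))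
          (≤-reflexive (mix-affine p u w θ _ _ _ _))

        -- A run that makes a call is credited with the full maximum `w`; only a run that outputs at
        -- once is compared with `base`.
        expectedValue-≤-callProbability : ∀ A →
          expectedValue f A ≤ u + w * (discovery θ f A + 1# * callProbability A)
        expectedValue-≤-callProbability (output X) = output-≤ X (*-nonNegative 0≤1 ≤-refl)
        expectedValue-≤-callProbability (query X κ) = begin
          expectedValue f (κ (f X))
            ≤⟨ f≤u+w[1+_] (expectedValue-≤ f f≤w (κ (f X))) (discovery-≥0 f (query X κ)) ⟩
          u + w * (1# + discovery θ f (query X κ))
            ≡⟨ cong (λ x → u + w * x) (+-comm 1# _) ⟩
          u + w * (discovery θ f (query X κ) + 1#)
            ≡⟨ cong (λ x → u + w * (discovery θ f (query X κ) + x)) (*-identityˡ 1#) ⟨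
          u + w * (discovery θ f (query X κ) + 1# * 1#)
            ∎
          where open ≤-Reasoning
        expectedValue-≤-callProbability (toss p 0≤p p≤1 A B) = ≤-trans
          (mix-mono 0≤p p≤1 (expectedValue-≤-callProbability A) (expectedValue-≤-callProbability B))
          (≤-reflexive (mix-affine p u w 1# _ _ _ _))

  -- From rarely revealing sets to a lower bound on the number of calls.

  uniform : ∀ {b} {B : Set b} Z → 0 ℕ.< Z → (Fin Z → B) → Distribution B
  uniform Z 0<Z outcome = record
    { size     = Z
    ; outcome  = outcome
    ; weight   = λ _ → fromℕ Z ⁻¹
    ; weight≥0 = λ _ → 0<⇒0≤⁻¹ (0<fromℕ 0<Z)
    ; weight-∑ = trans (sum-const Z _) (*-inverseʳ _ (0<x⇒x≢0 (0<fromℕ 0<Z)))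
    }

  HasHardDistribution : ℕ → Carrier → ℕ → ℕ → Set _
  HasHardDistribution k α g n =
    Σ[ D ∈ Distribution (Instance k n) ]
    ∀ (A : Algorithm n) → IsApproximation k α A →
    ∀ δ → 0# < δ → δ < 1# → 1# - δ ≤ Pr[calls≥ δ * fromℕ (2 ℕ.^ g) ] D A

  -- Divided by `fromℕ E * α`, the hypothesis `gap` says that the value `w / α` required of an
  -- approximation exceeds `u` by at least `2 w / E`.
  module _ {k n Z : ℕ} (0<Z : 0 ℕ.< Z) (I : Fin Z → Instance k n) (base : SetFunction n)
           {u w : Carrier} (0≤u : 0# ≤ u) (0<w : 0# < w) (base≤u : ∀ X → base X ≤ u)
           (isMax : ∀ b → IsMaximum (Instance.function (I b)) w)
           {α : Carrier} (1≤α : 1# ≤ α)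
           {E : ℕ} (0<E : 0 ℕ.< E)
           (gap : (1# + 1#) * (α * w) + fromℕ E * (α * u) ≤ fromℕ E * w)
           {s : ℕ} (rare : ∀ X → fromℕ (2 ℕ.^ s) * sum (λ b → reveals base (Instance.function (I b)) X) ≤ fromℕ Z)
           {g : ℕ} (E²2^g≤2^s : E ℕ.* E ℕ.* 2 ℕ.^ g ℕ.≤ 2 ℕ.^ s) where

    private
      F : Fin Z → SetFunction n
      F b = Instance.function (I b)

      D : Distribution (Instance k n)
      D = uniform Z 0<Z I

      e z p2s p2g γZ : Carrier
      e = fromℕ E
      z = fromℕ Z
      p2s = fromℕ (2 ℕ.^ s)
      p2g = fromℕ (2 ℕ.^ g)
      -- An upper bound for the number of instances that a fixed set reveals: the fraction
      -- `2 ^ (-s)` of all `Z`.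
      γZ = p2s ⁻¹ * z

      0≤w : 0# ≤ w
      0≤w = proj₁ 0<w

      0<z : 0# < z
      0<z = 0<fromℕ 0<Z

      0<p2s : 0# < p2s
      0<p2s = 0<fromℕ (ℕₚ.m^n>0 2 s)

      0<p2g : 0# < p2g
      0<p2g = 0<fromℕ (ℕₚ.m^n>0 2 g)

      0<e : 0# < e
      0<e = 0<fromℕ 0<E

      0≤e : 0# ≤ e
      0≤e = proj₁ 0<e

      0<α : 0# < α
      0<α = <-≤-trans 0<1 1≤α

      0≤γZ : 0# ≤ γZ
      0≤γZ = *-nonNegative (0<⇒0≤⁻¹ 0<p2s) (proj₁ 0<z)

      p2s*γZ≡z : p2s * γZ ≡ z
      p2s*γZ≡z = trans (sym (*-assoc p2s (p2s ⁻¹) z))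
        (trans (cong (_* z) (*-inverseʳ p2s (0<x⇒x≢0 0<p2s))) (*-identityˡ z))

      ∑-reveals-≤ : ∀ X → sum (λ b → reveals base (F b) X) ≤ γZ
      ∑-reveals-≤ X = *-cancelˡ-≤-pos 0<p2s (≤-trans (rare X) (≤-reflexive (sym p2s*γZ≡z)))

      e*e*p2g≤p2s : e * e * p2g ≤ p2s
      e*e*p2g≤p2s = begin
        e * e * p2g                    ≡⟨ cong (_* p2g) (fromℕ-homo-* E E) ⟨
        fromℕ (E ℕ.* E) * p2g          ≡⟨ fromℕ-homo-* (E ℕ.* E) (2 ℕ.^ g) ⟨
        fromℕ (E ℕ.* E ℕ.* 2 ℕ.^ g)    ≤⟨ fromℕ-mono-≤ E²2^g≤2^s ⟩
        p2s                            ∎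
        where open ≤-Reasoning

      e≤p2s : e ≤ p2s
      e≤p2s = fromℕ-mono-≤ (begin
        E                      ≡⟨ ℕₚ.*-identityʳ E ⟨
        E ℕ.* 1                ≤⟨ ℕₚ.*-monoʳ-≤ E 0<E ⟩
        E ℕ.* E                ≡⟨ ℕₚ.*-identityʳ (E ℕ.* E) ⟨
        E ℕ.* E ℕ.* 1          ≤⟨ ℕₚ.*-monoʳ-≤ (E ℕ.* E) (ℕₚ.m^n>0 2 g) ⟩
        E ℕ.* E ℕ.* 2 ℕ.^ g    ≤⟨ E²2^g≤2^s ⟩
        2 ℕ.^ s                ∎)
        where open ℕₚ.≤-Reasoning

      module _ (A : Algorithm n) (A-approx : IsApproximation k α A) where

        -- The approximation guarantee gives `w / α ≤ u + w * x`; by `gap`, the surplus `w * x` is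
        -- then at least `2 w / E`.
        2≤e* : ∀ b {x} → expectedValue (F b) A ≤ u + w * x → 1# + 1# ≤ e * x
        2≤e* b {x} v≤ = *-cancelˡ-≤-pos (0<⇒0<* 0<α 0<w) (+-cancelˡ-≤ (e * (α * u)) (begin
          e * (α * u) + (α * w) * (1# + 1#)
            ≡⟨ trans (+-comm _ _) (cong (_+ e * (α * u)) (*-comm (α * w) (1# + 1#))) ⟩
          (1# + 1#) * (α * w) + e * (α * u)
            ≤⟨ gap ⟩
          e * w
            ≡⟨ cong (e *_) (*-identityˡ w) ⟨
          e * (1# * w)
            ≡⟨ cong (λ y → e * (y * w)) (*-inverseʳ α (0<x⇒x≢0 0<α)) ⟨
          e * (α * α ⁻¹ * w)
            ≡⟨ cong (e *_) (*-assoc α (α ⁻¹) w) ⟩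
          e * (α * (α ⁻¹ * w))
            ≤⟨ *-monoˡ-≤-nonNeg 0≤e (*-monoˡ-≤-nonNeg (proj₁ 0<α)
                 (≤-trans (A-approx (F b) (Instance.isXOS (I b)) w (isMax b)) v≤)) ⟩
          e * (α * (u + w * x))
            ≡⟨ solve 5 (λ e α u w x → e :* (α :* (u :+ w :* x)) :=
                 e :* (α :* u) :+ (α :* w) :* (e :* x)) refl e α u w x ⟩
          e * (α * u) + (α * w) * (e * x) ∎))
          where open ≤-Reasoning

        module _ {t : Carrier} (0<t : 0# < t) where

          Pr[calls≥t] : Carrier
          Pr[calls≥t] = Pr[calls≥ t ] D A

          -- If t is below 1/E, it is enough that A makes a call at all with
          -- probability 1/E, and this probability is the same on every input.
          calls≥t : e * t ≤ 1# → ∀ b → t ≤ expectedCalls (F b) A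
          calls≥t et≤1 b =
            ≤-trans (*-cancelˡ-≤-pos 0<e (≤-trans et≤1 1≤eρ)) (callProbability≤expectedCalls (F b) A)
            where
            open ≤-Reasoning
            ρ : Carrier
            ρ = callProbability A
            Q : Fin Z → Carrier
            Q c = discovery base 1# (F c) A
            e*γZ≤z : e * γZ ≤ z
            e*γZ≤z = ≤-trans (*-monoʳ-≤-nonNeg 0≤γZ e≤p2s) (≤-reflexive p2s*γZ≡z)
            -- With `θ = 1#` the run stops after its first query, so no factor depending on `t` is
            -- lost.
            ∑Q≤γZ : sum Q ≤ γZ
            ∑Q≤γZ = ∑-discovery-≤ base 0≤1 ≤-refl F 0≤γZ
              (λ X → ≤-trans (∑-reveals-≤ X) (≤-reflexive (sym (*-identityˡ γZ)))) A
            -- Summed over all instances, `2≤e*` yields `2 z`. Discovery accounts for at most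
            -- `e * γZ ≤ z` of it, and calls must supply the other `z`.
            1≤eρ : 1# ≤ e * ρ
            1≤eρ = *-cancelˡ-≤-pos 0<z (+-cancelˡ-≤ (z * 1#) (begin
              z * 1# + z * 1#
                ≡⟨ distribˡ z 1# 1# ⟨
              z * (1# + 1#)
                ≡⟨ sum-const Z (1# + 1#) ⟨
              sum {Z} (λ _ → 1# + 1#)
                ≤⟨ sum-mono-≤ (λ c → 2≤e* c (expectedValue-≤-callProbability base 0≤1 ≤-refl
                     0≤u 0≤w base≤u (proj₂ (isMax c)) A)) ⟩
              sum (λ c → e * (Q c + 1# * ρ))
                ≡⟨ *-distribˡ-sum e (λ c → Q c + 1# * ρ) ⟨
              e * sum (λ c → Q c + 1# * ρ)
                ≡⟨ cong (e *_) (trans (∑-distrib-+ Q (λ _ → 1# * ρ))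
                     (cong (sum Q +_) (trans (sum-const Z (1# * ρ)) (cong (z *_) (*-identityˡ ρ))))) ⟩
              e * (sum Q + z * ρ)
                ≤⟨ *-monoˡ-≤-nonNeg 0≤e (+-monoˡ-≤ (z * ρ) ∑Q≤γZ) ⟩
              e * (γZ + z * ρ)
                ≡⟨ solve 4 (λ e c z ρ → e :* (c :+ z :* ρ) := e :* c :+ z :* (e :* ρ)) refl e γZ z ρ ⟩
              e * γZ + z * (e * ρ)
                ≤⟨ +-monoˡ-≤ (z * (e * ρ)) e*γZ≤z ⟩
              z + z * (e * ρ)
                ≡⟨ cong (_+ z * (e * ρ)) (*-identityʳ z) ⟨
              z * 1# + z * (e * ρ) ∎))

          few-calls : e * t ≤ 1# → 1# ≤ Pr[calls≥t]
          few-calls et≤1 = begin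
            1#                                      ≡⟨ Distribution.weight-∑ D ⟨
            sum (Distribution.weight D)             ≤⟨ sum-mono-≤ pointwise ⟩
            Pr[calls≥t]                             ∎
            where
            open ≤-Reasoning
            pointwise : ∀ b → z ⁻¹ ≤ (if does (t ≤? expectedCalls (F b) A) then z ⁻¹ else 0#)
            pointwise b with t ≤? expectedCalls (F b) A
            ... | yes _   = ≤-refl
            ... | no  t≰N = ⊥-elim (t≰N (calls≥t et≤1 b))

          -- An instance with fewer than `t` calls is discovered with probability at least `1 / E`,
          -- while the discovery probabilities sum to at most `E t γZ`. By Markov, such instances
          -- form a fraction of at most `E² t / 2 ^ s`; the claim is multiplied by `2 ^ s`.
          many-calls : 1# ≤ e * t → p2s * 1# ≤ p2s * Pr[calls≥t] + e * e * t
          many-calls 1≤et = begin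
            p2s * 1#
              ≡⟨ cong (p2s *_) (Distribution.weight-∑ D) ⟨
            p2s * sum (Distribution.weight D)
              ≤⟨ *-monoˡ-≤-nonNeg (proj₁ 0<p2s) (sum-mono-≤ pointwise) ⟩
            p2s * sum (λ b → good b + z ⁻¹ * (e * Q b))
              ≡⟨ cong (p2s *_) (trans (∑-distrib-+ good (λ b → z ⁻¹ * (e * Q b)))
                   (cong (sum good +_) (trans (sym (*-distribˡ-sum (z ⁻¹) (λ b → e * Q b)))
                     (cong (z ⁻¹ *_) (sym (*-distribˡ-sum e Q)))))) ⟩
            p2s * (sum good + z ⁻¹ * (e * sum Q))
              ≤⟨ *-monoˡ-≤-nonNeg (proj₁ 0<p2s) (+-monoʳ-≤ (sum good)
                   (*-monoˡ-≤-nonNeg (0<⇒0≤⁻¹ 0<z) (*-monoˡ-≤-nonNeg 0≤e ∑Q≤Γ))) ⟩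
            p2s * (sum good + z ⁻¹ * (e * (e * t * γZ)))
              ≡⟨ solve 6 (λ p G y e t c → p :* (G :+ y :* (e :* (e :* t :* c))) :=
                   p :* G :+ (p :* c) :* y :* (e :* e :* t)) refl p2s (sum good) (z ⁻¹) e t γZ ⟩
            p2s * sum good + p2s * γZ * z ⁻¹ * (e * e * t)
              ≡⟨ cong (λ y → p2s * sum good + y * (e * e * t))
                   (trans (cong (_* z ⁻¹) p2s*γZ≡z) (*-inverseʳ z (0<x⇒x≢0 0<z))) ⟩
            p2s * sum good + 1# * (e * e * t)
              ≡⟨ cong (p2s * sum good +_) (*-identityˡ (e * e * t)) ⟩
            p2s * Pr[calls≥t] + e * e * t ∎
            where
            open ≤-Reasoning
            0<et : 0# < e * t
            0<et = 0<⇒0<* 0<e 0<t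
            θ Γ : Carrier
            θ = (e * t) ⁻¹
            Γ = e * t * γZ
            et*θ≡1 : e * t * θ ≡ 1#
            et*θ≡1 = *-inverseʳ (e * t) (0<x⇒x≢0 0<et)
            0≤θ : 0# ≤ θ
            0≤θ = 0<⇒0≤⁻¹ 0<et
            θ≤1 : θ ≤ 1#
            θ≤1 = *-cancelˡ-≤-pos 0<et (begin
              e * t * θ   ≡⟨ et*θ≡1 ⟩
              1#          ≤⟨ 1≤et ⟩
              e * t       ≡⟨ *-identityʳ (e * t) ⟨
              e * t * 1#  ∎)
            θ*Γ≡γZ : θ * Γ ≡ γZ
            θ*Γ≡γZ = trans (sym (*-assoc θ (e * t) γZ))
              (trans (cong (_* γZ) (trans (*-comm θ (e * t)) et*θ≡1)) (*-identityˡ γZ))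
            Q good : Fin Z → Carrier
            Q b = discovery base θ (F b) A
            good b = if does (t ≤? expectedCalls (F b) A) then z ⁻¹ else 0#
            ∑Q≤Γ : sum Q ≤ Γ
            ∑Q≤Γ = ∑-discovery-≤ base 0≤θ θ≤1 F (*-nonNegative (proj₁ 0<et) 0≤γZ)
              (λ X → ≤-trans (∑-reveals-≤ X) (≤-reflexive (sym θ*Γ≡γZ))) A
            -- Fewer than `t` calls account for at most `e * θ * t`, that is `1#`, of the required
            -- two; discovery must supply the rest.
            1≤eQ : ∀ b → ¬ t ≤ expectedCalls (F b) A → 1# ≤ e * Q b
            1≤eQ b t≰N = +-cancelˡ-≤ 1# (begin
              1# + 1#
                ≤⟨ 2≤e* b (expectedValue-≤-calls base 0≤θ θ≤1 0≤u 0≤w base≤u (proj₂ (isMax b)) A) ⟩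
              e * (Q b + θ * expectedCalls (F b) A)
                ≤⟨ *-monoˡ-≤-nonNeg 0≤e (+-monoʳ-≤ (Q b) (*-monoˡ-≤-nonNeg 0≤θ (proj₁ (≰⇒> t≰N)))) ⟩
              e * (Q b + θ * t)
                ≡⟨ solve 4 (λ e q θ t → e :* (q :+ θ :* t) := e :* t :* θ :+ e :* q) refl e (Q b) θ t ⟩
              e * t * θ + e * Q b
                ≡⟨ cong (_+ e * Q b) et*θ≡1 ⟩
              1# + e * Q b ∎)
            pointwise : ∀ b → z ⁻¹ ≤ good b + z ⁻¹ * (e * Q b)
            pointwise b with t ≤? expectedCalls (F b) A
            ... | yes _   = x≤x+y (*-nonNegative (0<⇒0≤⁻¹ 0<z)
              (*-nonNegative 0≤e (discovery-≥0 base 0≤θ θ≤1 (F b) A)))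
            ... | no  t≰N = begin
              z ⁻¹                         ≡⟨ *-identityʳ (z ⁻¹) ⟨
              z ⁻¹ * 1#                    ≤⟨ *-monoˡ-≤-nonNeg (0<⇒0≤⁻¹ 0<z) (1≤eQ b t≰N) ⟩
              z ⁻¹ * (e * Q b)             ≡⟨ +-identityˡ _ ⟨
              0# + z ⁻¹ * (e * Q b)        ∎

    hardDistribution : HasHardDistribution k α g n
    hardDistribution = D , bound
      where
      open ≤-Reasoning
      bound : ∀ A → IsApproximation k α A →
        ∀ δ → 0# < δ → δ < 1# → 1# - δ ≤ Pr[calls≥ δ * p2g ] D A
      -- For `t = δ * p2g`, abandoning with probability `1 / (E t)` makes sense when `E t ≥ 1`. In
      -- that case the failing fraction is at most `δ`, by `E² * 2 ^ g ≤ 2 ^ s`.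
      bound A A-approx δ 0<δ δ<1 with ≤-total (e * (δ * p2g)) 1#
      ... | inj₁ et≤1 = x-y≤z⇒x≤z+y (≤-trans (few-calls A A-approx (0<⇒0<* 0<δ 0<p2g) et≤1) (x≤x+y (proj₁ 0<δ)))
      ... | inj₂ 1≤et = x-y≤z⇒x≤z+y (*-cancelˡ-≤-pos 0<p2s (begin
        p2s * 1#                              ≤⟨ many-calls A A-approx (0<⇒0<* 0<δ 0<p2g) 1≤et ⟩
        p2s * Prt + e * e * (δ * p2g)         ≡⟨ cong (p2s * Prt +_) (solve 3 (λ e δ p →
                                                   e :* e :* (δ :* p) := (e :* e :* p) :* δ) refl e δ p2g) ⟩
        p2s * Prt + e * e * p2g * δ           ≤⟨ +-monoʳ-≤ _ (*-monoʳ-≤-nonNeg (proj₁ 0<δ) e*e*p2g≤p2s) ⟩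
        p2s * Prt + p2s * δ                   ≡⟨ distribˡ p2s Prt δ ⟨
        p2s * (Prt + δ)                       ∎))
        where
        Prt : Carrier
        Prt = Pr[calls≥ δ * p2g ] D A

  -- Additive functions given by coefficients.

  ∑[_]-cong : ∀ {n} (X : Subset n) {f g : Fin n → Carrier} → (∀ v → f v ≡ g v) → ∑[ X ] f ≡ ∑[ X ] g
  ∑[ X ]-cong f≡g = sum-cong-≗ λ v → cong (if lookup X v then_else 0#) (f≡g v)

  ∑[]-distrib-+ : ∀ {n} (X : Subset n) (f g : Fin n → Carrier) → ∑[ X ] (λ v → f v + g v) ≡ ∑[ X ] f + ∑[ X ] g
  ∑[]-distrib-+ X f g = trans (sum-cong-≗ pointwise) (∑-distrib-+ (λ v → if lookup X v then f v else 0#) (λ v → if lookup X v then g v else 0#))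
    where
    pointwise : ∀ v → (if lookup X v then f v + g v else 0#) ≡
      (if lookup X v then f v else 0#) + (if lookup X v then g v else 0#)
    pointwise v with lookup X v
    ... | true  = refl
    ... | false = sym (+-identityˡ 0#)

  ∑[∅] : ∀ {n} (f : Fin n → Carrier) → ∑[ ∅ ] f ≡ 0#
  ∑[∅] {zero}  f = refl
  ∑[∅] {suc n} f = trans (+-identityˡ _) (∑[∅] (f ∘ suc))

  ∑[⁅v⁆] : ∀ {n} (f : Fin n → Carrier) v → ∑[ ⁅ v ⁆ ] f ≡ f v
  ∑[⁅v⁆] f zero    = trans (cong (f zero +_) (∑[∅] (f ∘ suc))) (+-identityʳ (f zero))
  ∑[⁅v⁆] f (suc v) = trans (+-identityˡ _) (∑[⁅v⁆] (f ∘ suc) v)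

  ∑[]-additive : ∀ {n} (f : Fin n → Carrier) → IsAdditive (λ X → ∑[ X ] f)
  ∑[]-additive f X = ∑[ X ]-cong λ v → sym (∑[⁅v⁆] f v)

  fromℕ-∑ : ∀ {n} (f : Fin n → ℕ) → fromℕ (∑ f) ≡ sum (fromℕ ∘ f)
  fromℕ-∑ {zero}  f = refl
  fromℕ-∑ {suc n} f = trans (fromℕ-homo-+ (f zero) _) (cong (fromℕ (f zero) +_) (fromℕ-∑ (f ∘ suc)))

  ∑[]-fromℕ : ∀ {n} (X : Subset n) (f : Fin n → ℕ) → ∑[ X ] (fromℕ ∘ f) ≡ fromℕ (∑ (λ v → χ X v ℕ.* f v))
  ∑[]-fromℕ X f = trans (sum-cong-≗ pointwise) (sym (fromℕ-∑ (λ v → χ X v ℕ.* f v)))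
    where
    pointwise : ∀ v → (if lookup X v then fromℕ (f v) else 0#) ≡ fromℕ (χ X v ℕ.* f v)
    pointwise v with lookup X v
    ... | true  = cong fromℕ (sym (ℕₚ.+-identityʳ (f v)))
    ... | false = refl

  -- The hidden instances and their properties.

  module _ {B κ′ : ℕ} (l r q s P : ℕ) .{{_ : NonZero l}} .{{_ : NonZero q}}
           (L*L*s≤q : suc l ℕ.* (suc l ℕ.* s) ℕ.≤ q)
           (cls : Fin B → Fin (suc κ′)) (wt : Fin B → ℕ) (ω : Fin (suc κ′) → ℕ)
           (wt-ω : ∀ β → wt β ≡ 0 ⊎ wt β ≡ ω (cls β))
           (decay : ∀ {i j} → toℕ i ℕ.< toℕ j → q ℕ.* ω j ℕ.≤ ω i)
           (∑-class : ∀ j → ∑ (λ β → wt β ℕ.* δ (cls β) j) ≡ P)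
           (L+1≤κl : suc (suc l) ℕ.≤ suc κ′ ℕ.* l) where

    private
      L κ n u w : ℕ
      L = suc l
      κ = suc κ′
      n = B ℕ.* L ℕ.+ r
      -- `u` is the value of a full class, with `L` positions per block; `w` is the value of all
      -- non-traps, `l` per block, over all `κ` classes. Their ratio is `(l + 2) : κ l`.
      u = L ℕ.* P ℕ.* suc L
      w = L ℕ.* P ℕ.* (κ ℕ.* l)

      y : Subset n → Fin B → Fin L → ℕ
      y X β p = χ X (cell r β p)

      -- All values are scaled by `L`, so that the factor `1 + 1/L` of the class functions becomes
      -- `suc L` against `L` here.
      hidden : Subset n → ℕ
      hidden X = ∑∑ (λ β p → y X β p ℕ.* (L ℕ.* wt β))

      classValue : Fin κ → Subset n → ℕ
      classValue j X = ∑∑ (λ β p → y X β p ℕ.* (suc L ℕ.* (wt β ℕ.* δ (cls β) j)))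

      base : Subset n → ℕ
      base X = ⨆ (λ j → classValue j X)

      traps : (Fin B → Fin L) → Subset n → ℕ
      traps b X = ∑ (λ β → y X β (b β))

      value : (Fin B → Fin L) → Subset n → ℕ
      value b X = unlessTrapped (traps b X) (hidden X) (base X)

      ∑wt≡κP : ∑ wt ≡ κ ℕ.* P
      ∑wt≡κP = begin
        ∑ wt                                         ≡⟨ ∑-cong (λ β → trans (sym (ℕₚ.*-identityʳ (wt β)))
                                                          (trans (cong (wt β ℕ.*_) (sym (∑-δ (cls β)))) (*-distribˡ-∑ (wt β) (δ (cls β))))) ⟩
        ∑∑ (λ β j → wt β ℕ.* δ (cls β) j)            ≡⟨ ∑-swap (λ β j → wt β ℕ.* δ (cls β) j) ⟩
        ∑∑ (λ j β → wt β ℕ.* δ (cls β) j)            ≡⟨ ∑-cong ∑-class ⟩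
        ∑ {κ} (λ _ → P)                              ≡⟨ ∑-const κ P ⟩
        κ ℕ.* P                                      ∎
        where open ≡-Reasoning

      y≤1 : ∀ X β p → y X β p ℕ.≤ 1
      y≤1 X β p = χ≤1 X (cell r β p)

      y*-≤ : ∀ X β p {x} → y X β p ℕ.* x ℕ.≤ x
      y*-≤ X β p {x} = ℕₚ.≤-trans (ℕₚ.*-monoˡ-≤ x (y≤1 X β p)) (ℕₚ.≤-reflexive (ℕₚ.*-identityˡ x))

      classValue≤u : ∀ j X → classValue j X ℕ.≤ u
      classValue≤u j X = begin
        classValue j X
          ≤⟨ ∑∑-mono-≤ {g = λ β _ → suc L ℕ.* (wt β ℕ.* δ (cls β) j)} (λ β p → y*-≤ X β p) ⟩
        ∑∑ {B} {L} (λ β p → suc L ℕ.* (wt β ℕ.* δ (cls β) j))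
          ≡⟨ ∑∑-const L (λ β → suc L ℕ.* (wt β ℕ.* δ (cls β) j)) ⟩
        L ℕ.* ∑ (λ β → suc L ℕ.* (wt β ℕ.* δ (cls β) j))
          ≡⟨ cong (L ℕ.*_) (trans (sym (*-distribˡ-∑ (suc L) (λ β → wt β ℕ.* δ (cls β) j))) (cong (suc L ℕ.*_) (∑-class j))) ⟩
        L ℕ.* (suc L ℕ.* P)
          ≡⟨ +-*-Solver.solve 3 (λ x y z → x :*ℕ (y :*ℕ z) :=ℕ (x :*ℕ z) :*ℕ y) refl L (suc L) P ⟩
        u ∎
        where
        open ℕₚ.≤-Reasoning
        open +-*-Solver using () renaming (_:*_ to _:*ℕ_; _:=_ to _:=ℕ_)

      base≤u : ∀ X → base X ℕ.≤ u
      base≤u X = ⨆-≤ (λ j → classValue≤u j X)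

      u≤w : u ℕ.≤ w
      u≤w = ℕₚ.*-monoʳ-≤ (L ℕ.* P) L+1≤κl

      good : (Fin B → Fin L) → Fin B → Fin L → ℕ
      good b β p = if not (does (p Finₚ.≟ b β)) then 1 else 0

      good+δ : ∀ b β p → good b β p ℕ.+ δ p (b β) ≡ 1
      good+δ b β p with p Finₚ.≟ b β
      ... | yes _ = refl
      ... | no  _ = refl

      ∑-good : ∀ b β → ∑ (good b β) ≡ l
      ∑-good b β = ℕₚ.+-cancelʳ-≡ 1 _ _ (begin
        ∑ (good b β) ℕ.+ 1                        ≡⟨ cong (∑ (good b β) ℕ.+_) (trans (∑-cong λ p → δ-sym p (b β)) (∑-δ (b β))) ⟨
        ∑ (good b β) ℕ.+ ∑ (λ p → δ p (b β))      ≡⟨ ∑-+ (good b β) (λ p → δ p (b β)) ⟨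
        ∑ (λ p → good b β p ℕ.+ δ p (b β))        ≡⟨ ∑-cong (good+δ b β) ⟩
        ∑ {L} (λ _ → 1)                           ≡⟨ trans (∑-const L 1) (ℕₚ.*-identityʳ L) ⟩
        L                                         ≡⟨ ℕₚ.+-comm 1 l ⟩
        l ℕ.+ 1                                   ∎)
        where open ≡-Reasoning

      ∑-good-wt : ∀ b → ∑∑ (λ β p → good b β p ℕ.* (L ℕ.* wt β)) ≡ w
      ∑-good-wt b = begin
        ∑∑ (λ β p → good b β p ℕ.* (L ℕ.* wt β))
          ≡⟨ ∑-cong (λ β → trans (sym (*-distribʳ-∑ (L ℕ.* wt β) (good b β))) (trans (cong (ℕ._* (L ℕ.* wt β)) (∑-good b β))
               (sym (ℕₚ.*-assoc l L (wt β))))) ⟩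
        ∑ (λ β → l ℕ.* L ℕ.* wt β)
          ≡⟨ trans (sym (*-distribˡ-∑ (l ℕ.* L) wt)) (cong (l ℕ.* L ℕ.*_) ∑wt≡κP) ⟩
        l ℕ.* L ℕ.* (κ ℕ.* P)
          ≡⟨ +-*-Solver.solve 4 (λ l L κ P → (l :*ℕ L) :*ℕ (κ :*ℕ P) :=ℕ (L :*ℕ P) :*ℕ (κ :*ℕ l)) refl l L κ P ⟩
        w ∎
        where
        open ≡-Reasoning
        open +-*-Solver using () renaming (_:*_ to _:*ℕ_; _:=_ to _:=ℕ_)

      y≤good : ∀ b X → traps b X ≡ 0 → ∀ β p → y X β p ℕ.≤ good b β p
      y≤good b X traps≡0 β p with p Finₚ.≟ b β
      ... | yes refl = subst (y X β (b β) ℕ.≤_) traps≡0 (term≤∑ (λ β → y X β (b β)) β)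
      ... | no  _    = y≤1 X β p

      value≤w : ∀ b X → value b X ℕ.≤ w
      value≤w b X with traps b X in eq
      ... | zero  = ℕₚ.⊔-lub (begin
        hidden X                                     ≤⟨ ∑∑-mono-≤ (λ β p → ℕₚ.*-monoˡ-≤ (L ℕ.* wt β) (y≤good b X eq β p)) ⟩
        ∑∑ (λ β p → good b β p ℕ.* (L ℕ.* wt β))     ≡⟨ ∑-good-wt b ⟩
        w                                            ∎)
        (ℕₚ.≤-trans (base≤u X) u≤w)
        where open ℕₚ.≤-Reasoning
      ... | suc _ = ℕₚ.≤-trans (base≤u X) u≤w

      optimum : (Fin B → Fin L) → Subset n
      optimum b = tabulate (extend r (λ β p → not (does (p Finₚ.≟ b β))) false)

      y-optimum : ∀ b β p → y (optimum b) β p ≡ good b β p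
      y-optimum b β p = cong (if_then 1 else 0) (trans
        (lookup∘tabulate (extend r (λ β p → not (does (p Finₚ.≟ b β))) false) (cell r β p))
        (extend-cell r (λ β p → not (does (p Finₚ.≟ b β))) false β p))

      traps-optimum : ∀ b → traps b (optimum b) ≡ 0
      traps-optimum b = trans (∑-cong (λ β → trans (y-optimum b β (b β)) (good≡0 β))) (∑-zero B)
        where
        good≡0 : ∀ β → good b β (b β) ≡ 0
        good≡0 β = ℕₚ.+-cancelʳ-≡ 1 _ _ (trans (cong (good b β (b β) ℕ.+_) (sym (δ-refl (b β)))) (good+δ b β (b β)))

      value-optimum : ∀ b → value b (optimum b) ≡ w
      value-optimum b = ℕₚ.≤-antisym (value≤w b (optimum b)) (begin
        w                                            ≡⟨ ∑-good-wt b ⟨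
        ∑∑ (λ β p → good b β p ℕ.* (L ℕ.* wt β))     ≡⟨ ∑∑-cong (λ β p → cong (ℕ._* (L ℕ.* wt β)) (y-optimum b β p)) ⟨
        hidden (optimum b)                           ≤⟨ ℕₚ.m≤m⊔n _ _ ⟩
        hidden (optimum b) ℕ.⊔ base (optimum b)      ≡⟨ cong (λ t → unlessTrapped t (hidden (optimum b)) (base (optimum b))) (traps-optimum b) ⟨
        value b (optimum b)                          ∎)
        where open ℕₚ.≤-Reasoning

      -- The finite substitute for an infinite penalty: the value of the whole ground set before
      -- penalties, so that one trap brings the hidden function down to at most 0.
      M : ℕ
      M = L ℕ.* (L ℕ.* ∑ wt)

      hidden≤M : ∀ X → hidden X ℕ.≤ M
      hidden≤M X = begin
        hidden X                              ≤⟨ ∑∑-mono-≤ {g = λ β _ → L ℕ.* wt β} (λ β p → y*-≤ X β p) ⟩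
        ∑∑ {B} {L} (λ β _ → L ℕ.* wt β)       ≡⟨ ∑∑-const L (λ β → L ℕ.* wt β) ⟩
        L ℕ.* ∑ (λ β → L ℕ.* wt β)            ≡⟨ cong (L ℕ.*_) (*-distribˡ-∑ L wt) ⟨
        M                                     ∎
        where open ℕₚ.≤-Reasoning

      ∑-traps : ∀ b X → ∑∑ (λ β p → y X β p ℕ.* (M ℕ.* δ p (b β))) ≡ M ℕ.* traps b X
      ∑-traps b X = begin
        ∑∑ (λ β p → y X β p ℕ.* (M ℕ.* δ p (b β)))
          ≡⟨ ∑∑-cong (λ β p → +-*-Solver.solve 3 (λ y m d → y :*ℕ (m :*ℕ d) :=ℕ m :*ℕ (y :*ℕ d)) refl (y X β p) M (δ p (b β))) ⟩
        ∑∑ (λ β p → M ℕ.* (y X β p ℕ.* δ p (b β)))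
          ≡⟨ *-distribˡ-∑∑ M (λ β p → y X β p ℕ.* δ p (b β)) ⟨
        M ℕ.* ∑∑ (λ β p → y X β p ℕ.* δ p (b β))
          ≡⟨ cong (M ℕ.*_) (∑-cong λ β → ∑-*-δ (y X β) (b β)) ⟩
        M ℕ.* traps b X ∎
        where
        open ≡-Reasoning
        open +-*-Solver using () renaming (_:*_ to _:*ℕ_; _:=_ to _:=ℕ_)

      weightCoefficient : Fin n → Carrier
      weightCoefficient v = fromℕ (extend {L = L} r (λ β _ → L ℕ.* wt β) 0 v)

      trapCoefficient : (Fin B → Fin L) → Fin n → Carrier
      trapCoefficient b v = fromℕ (extend r (λ β p → M ℕ.* δ p (b β)) 0 v)

      hiddenCoefficient : (Fin B → Fin L) → Fin n → Carrier
      hiddenCoefficient b v = weightCoefficient v - trapCoefficient b v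

      classCoefficient : Fin κ → Fin n → Carrier
      classCoefficient j v = fromℕ (extend {L = L} r (λ β _ → suc L ℕ.* (wt β ℕ.* δ (cls β) j)) 0 v)

      coefficient : (Fin B → Fin L) → Fin (suc κ) → Fin n → Carrier
      coefficient b zero    = hiddenCoefficient b
      coefficient b (suc j) = classCoefficient j

      ∑[]-extend : ∀ X (f : Fin B → Fin L → ℕ) →
        ∑[ X ] (λ v → fromℕ (extend r f 0 v)) ≡ fromℕ (∑∑ (λ β p → y X β p ℕ.* f β p))
      ∑[]-extend X f = trans (∑[]-fromℕ X (extend r f 0)) (cong fromℕ (∑-extend r X f))

      ∑-classCoefficient : ∀ X j → ∑[ X ] (classCoefficient j) ≡ fromℕ (classValue j X)
      ∑-classCoefficient X j = ∑[]-extend X (λ β _ → suc L ℕ.* (wt β ℕ.* δ (cls β) j))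

      -- The penalty is kept on the left, which leaves a natural number on the right.
      ∑-hiddenCoefficient : ∀ b X → ∑[ X ] (hiddenCoefficient b) + fromℕ (M ℕ.* traps b X) ≡ fromℕ (hidden X)
      ∑-hiddenCoefficient b X = begin
        ∑[ X ] (hiddenCoefficient b) + fromℕ (M ℕ.* traps b X)
          ≡⟨ cong (λ x → ∑[ X ] (hiddenCoefficient b) + x) (trans (∑[]-extend X (λ β p → M ℕ.* δ p (b β))) (cong fromℕ (∑-traps b X))) ⟨
        ∑[ X ] (hiddenCoefficient b) + ∑[ X ] (trapCoefficient b)
          ≡⟨ ∑[]-distrib-+ X (hiddenCoefficient b) (trapCoefficient b) ⟨
        ∑[ X ] (λ v → hiddenCoefficient b v + trapCoefficient b v)
          ≡⟨ ∑[ X ]-cong (λ v → trans (+-comm _ _) (x+y-x≡y (trapCoefficient b v) (weightCoefficient v))) ⟩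
        ∑[ X ] weightCoefficient
          ≡⟨ ∑[]-extend X (λ β _ → L ℕ.* wt β) ⟩
        fromℕ (hidden X) ∎
        where open ≡-Reasoning

      isMaximum : ∀ b X → IsMaximum (λ i → ∑[ X ] (coefficient b i)) (fromℕ (value b X))
      isMaximum b X with traps b X | ∑-hiddenCoefficient b X
      ... | zero | ∑h≡ = attained , bounded
        where
        ∑h≡hidden : ∑[ X ] (hiddenCoefficient b) ≡ fromℕ (hidden X)
        ∑h≡hidden = trans (sym (+-identityʳ _)) (trans (cong (λ m → ∑[ X ] (hiddenCoefficient b) + fromℕ m) (sym (ℕₚ.*-zeroʳ M))) ∑h≡)
        attained : ∃[ i ] ∑[ X ] (coefficient b i) ≡ fromℕ (hidden X ℕ.⊔ base X)
        attained with ℕₚ.⊔-sel (hidden X) (base X) | ⨆-attained (λ j → classValue j X)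
        ... | inj₁ eq | _           = zero , trans ∑h≡hidden (cong fromℕ (sym eq))
        ... | inj₂ eq | j , classⱼ≡ = suc j , trans (∑-classCoefficient X j) (cong fromℕ (trans classⱼ≡ (sym eq)))
        bounded : ∀ i → ∑[ X ] (coefficient b i) ≤ fromℕ (hidden X ℕ.⊔ base X)
        bounded zero    = subst (_≤ fromℕ (hidden X ℕ.⊔ base X)) (sym ∑h≡hidden) (fromℕ-mono-≤ (ℕₚ.m≤m⊔n (hidden X) (base X)))
        bounded (suc j) = subst (_≤ fromℕ (hidden X ℕ.⊔ base X)) (sym (∑-classCoefficient X j))
          (fromℕ-mono-≤ (ℕₚ.≤-trans (≤⨆ (λ j → classValue j X) j) (ℕₚ.m≤n⊔m (hidden X) (base X))))
      ... | suc t | ∑h≡ = attained , bounded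
        where
        attained : ∃[ i ] ∑[ X ] (coefficient b i) ≡ fromℕ (base X)
        attained with ⨆-attained (λ j → classValue j X)
        ... | j , classⱼ≡ = suc j , trans (∑-classCoefficient X j) (cong fromℕ classⱼ≡)
        bounded : ∀ i → ∑[ X ] (coefficient b i) ≤ fromℕ (base X)
        bounded (suc j) = subst (_≤ fromℕ (base X)) (sym (∑-classCoefficient X j)) (fromℕ-mono-≤ (≤⨆ (λ j → classValue j X) j))
        -- At least one penalty `M` outweighs `hidden X`, so the hidden sum is at most 0, and base
        -- values are nonnegative.
        bounded zero    = ≤-trans (+-cancelˡ-≤ (fromℕ (M ℕ.* suc t)) (begin
          fromℕ (M ℕ.* suc t) + ∑[ X ] (hiddenCoefficient b)  ≡⟨ trans (+-comm _ _) ∑h≡ ⟩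
          fromℕ (hidden X)                                    ≤⟨ fromℕ-mono-≤ (ℕₚ.≤-trans (hidden≤M X) (ℕₚ.m≤m*n M (suc t))) ⟩
          fromℕ (M ℕ.* suc t)                                 ≡⟨ +-identityʳ _ ⟨
          fromℕ (M ℕ.* suc t) + 0#                            ∎)) (0≤fromℕ (base X))
          where open ≤-Reasoning

      -- A number below `L ^ B` encodes one trap per block, so a uniform number means independent
      -- uniform traps.
      instances : Fin (L ℕ.^ B) → Instance (suc κ) n
      instances c = record
        { function = λ X → fromℕ (value (finToFun c) X)
        ; isXOS    = (λ i X → ∑[ X ] (coefficient (finToFun c) i)) , (λ i → ∑[]-additive (coefficient (finToFun c) i)) , isMaximum (finToFun c)
        }

      reveal : Fin (L ℕ.^ B) → Subset n → Carrier
      reveal c = reveals (fromℕ ∘ base) (Instance.function (instances c))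

      base≡value : ∀ b X → hidden X ℕ.≤ base X → value b X ≡ base X
      base≡value b X hidden≤base with traps b X
      ... | zero  = ℕₚ.m≤n⇒m⊔n≡n hidden≤base
      ... | suc _ = refl

      reveal≡0 : ∀ c X → value (finToFun c) X ≡ base X → reveal c X ≡ 0#
      reveal≡0 c X eq with fromℕ (value (finToFun c) X) ≟ fromℕ (base X)
      ... | yes _   = refl
      ... | no  neq = ⊥-elim (neq (cong fromℕ eq))

      reveal≤isZero : ∀ c X → reveal c X ≤ fromℕ (isZero (traps (finToFun c) X))
      reveal≤isZero c X = by-traps (traps (finToFun c) X) refl
        where
        by-traps : ∀ t → traps (finToFun c) X ≡ t → reveal c X ≤ fromℕ (isZero t)
        by-traps zero    _  = ≤-trans (reveals-≤1 (fromℕ ∘ base) (Instance.function (instances c)) X) (≤-reflexive (sym (+-identityʳ 1#)))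
        by-traps (suc t) eq = ≤-reflexive (reveal≡0 c X (cong (λ t → unlessTrapped t (hidden X) (base X)) eq))

      -- A set with at least `L * s` elements in blocks avoids all traps for few `b`. A smaller one
      -- satisfies the size condition of `heaviest-class-dominates` by `L*L*s≤q`, so its hidden
      -- value never exceeds the base value.
      rare : ∀ X → fromℕ (2 ℕ.^ s) * sum (λ c → reveal c X) ≤ fromℕ (L ℕ.^ B)
      rare X with ℕₚ.≤-total (L ℕ.* s) (∑∑ (y X))
      ... | inj₁ Ls≤c = begin
        fromℕ (2 ℕ.^ s) * sum (λ c → reveal c X)
          ≤⟨ *-monoˡ-≤-nonNeg (0≤fromℕ (2 ℕ.^ s)) (sum-mono-≤ (λ c → reveal≤isZero c X)) ⟩
        fromℕ (2 ℕ.^ s) * sum (λ c → fromℕ (isZero (traps (finToFun c) X)))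
          ≡⟨ cong (fromℕ (2 ℕ.^ s) *_) (fromℕ-∑ (λ c → isZero (traps (finToFun c) X))) ⟨
        fromℕ (2 ℕ.^ s) * fromℕ (∑ (λ c → isZero (traps (finToFun c) X)))
          ≡⟨ fromℕ-homo-* (2 ℕ.^ s) _ ⟨
        fromℕ (2 ℕ.^ s ℕ.* ∑ (λ c → isZero (traps (finToFun c) X)))
          ≤⟨ fromℕ-mono-≤ (avoiding-rare l s (y X) (y≤1 X) Ls≤c) ⟩
        fromℕ (L ℕ.^ B) ∎
        where open ≤-Reasoning
      ... | inj₂ c≤Ls = begin
        fromℕ (2 ℕ.^ s) * sum (λ c → reveal c X)          ≡⟨ cong (fromℕ (2 ℕ.^ s) *_) (sum-cong-≗ λ c → reveal≡0 c X (base≡value (finToFun c) X hidden≤base)) ⟩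
        fromℕ (2 ℕ.^ s) * sum {L ℕ.^ B} (λ _ → 0#)        ≡⟨ cong (fromℕ (2 ℕ.^ s) *_) (trans (sum-const (L ℕ.^ B) 0#) (zeroʳ _)) ⟩
        fromℕ (2 ℕ.^ s) * 0#                              ≡⟨ zeroʳ _ ⟩
        0#                                                ≤⟨ 0≤fromℕ (L ℕ.^ B) ⟩
        fromℕ (L ℕ.^ B)                                   ∎
        where
        open ≤-Reasoning
        pull : ∀ c (f : Fin B → ℕ) → ∑∑ (λ β p → y X β p ℕ.* (c ℕ.* f β)) ≡ c ℕ.* ∑∑ (λ β p → y X β p ℕ.* f β)
        pull c f = trans (∑∑-cong λ β p → +-*-Solver.solve 3 (λ y m d → y :*ℕ (m :*ℕ d) :=ℕ m :*ℕ (y :*ℕ d)) refl (y X β p) c (f β))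
          (sym (*-distribˡ-∑∑ c (λ β p → y X β p ℕ.* f β)))
          where open +-*-Solver using () renaming (_:*_ to _:*ℕ_; _:=_ to _:=ℕ_)
        hidden≤base : hidden X ℕ.≤ base X
        hidden≤base = ℕₚ.≤-trans (ℕₚ.≤-reflexive (pull L wt)) (ℕₚ.≤-trans
          (heaviest-class-dominates q cls wt ω wt-ω decay (y X) (ℕₚ.≤-trans (ℕₚ.*-monoʳ-≤ L c≤Ls) L*L*s≤q))
          (⨆-≤ (λ j → ℕₚ.≤-trans (ℕₚ.≤-reflexive (sym (pull (suc L) (λ β → wt β ℕ.* δ (cls β) j)))) (≤⨆ (λ j → classValue j X) j))))

      instances-maximum : ∀ c → IsMaximum (Instance.function (instances c)) (fromℕ w)
      instances-maximum c = (optimum (finToFun c) , cong fromℕ (value-optimum (finToFun c))) , λ X → fromℕ-mono-≤ (value≤w (finToFun c) X)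

    hiddenDistribution : ∀ {α} → 1# ≤ α → 0 ℕ.< w → ∀ {E} → 0 ℕ.< E →
      (1# + 1#) * (α * fromℕ w) + fromℕ E * (α * fromℕ u) ≤ fromℕ E * fromℕ w →
      ∀ {g} → E ℕ.* E ℕ.* 2 ℕ.^ g ℕ.≤ 2 ℕ.^ s →
      HasHardDistribution (suc κ) α g n
    hiddenDistribution 1≤α 0<w 0<E gap {g} E²2^g≤2^s =
      hardDistribution (ℕₚ.m^n>0 L B) instances (fromℕ ∘ base) (0≤fromℕ u) (0<fromℕ 0<w)
        (λ X → fromℕ-mono-≤ (base≤u X)) instances-maximum 1≤α 0<E gap {s} rare {g} E²2^g≤2^s

  -- Choice of the block length and of the constant `E`.

  module Gap (κ : ℕ)
    {ε α : Carrier}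
    (0<ε : 0# < ε) (1≤α : 1# ≤ α) (α+ε≡κ : α + ε ≡ fromℕ κ) where

    private
      N-bound : ∃[ N ] ε ⁻¹ * fromℕ (2 ℕ.* κ ℕ.+ 1) ≤ fromℕ N
      N-bound = archimedean (ε ⁻¹ * fromℕ (2 ℕ.* κ ℕ.+ 1))

    -- The archimedean bound makes `ε * l` at least `2 κ + 1`; the summand 2 ensures `2 ≤ l`, from
    -- which the optimum exceeds a full class. `E` is large enough for `2 α κ l ≤ E`.
    l L E : ℕ
    l = 2 ℕ.+ proj₁ N-bound
    L = suc l
    E = 2 ℕ.* κ ℕ.* κ ℕ.* L

    private
      K λl two e : Carrier
      K = fromℕ κ
      λl = fromℕ l
      two = 1# + 1#
      e = fromℕ E

      0≤α : 0# ≤ α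
      0≤α = ≤-trans 0≤1 1≤α

      two≡fromℕ2 : two ≡ fromℕ 2
      two≡fromℕ2 = cong (1# +_) (sym (+-identityʳ 1#))

      0≤two : 0# ≤ two
      0≤two = 0≤x+y 0≤1 0≤1

      α≤K : α ≤ K
      α≤K = ≤-trans (x≤x+y (proj₁ 0<ε)) (≤-reflexive α+ε≡κ)

      2K+1≤ελl : two * K + 1# ≤ ε * λl
      2K+1≤ελl = begin
        two * K + 1#                                ≡⟨ cong₂ (λ x y → x * K + y) two≡fromℕ2 (sym (+-identityʳ 1#)) ⟩
        fromℕ 2 * K + fromℕ 1                       ≡⟨ cong (_+ fromℕ 1) (fromℕ-homo-* 2 κ) ⟨
        fromℕ (2 ℕ.* κ) + fromℕ 1                   ≡⟨ fromℕ-homo-+ (2 ℕ.* κ) 1 ⟨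
        fromℕ (2 ℕ.* κ ℕ.+ 1)                       ≡⟨ *-identityˡ _ ⟨
        1# * fromℕ (2 ℕ.* κ ℕ.+ 1)                  ≡⟨ cong (_* fromℕ (2 ℕ.* κ ℕ.+ 1)) (*-inverseʳ ε (0<x⇒x≢0 0<ε)) ⟨
        ε * ε ⁻¹ * fromℕ (2 ℕ.* κ ℕ.+ 1)            ≡⟨ *-assoc ε (ε ⁻¹) _ ⟩
        ε * (ε ⁻¹ * fromℕ (2 ℕ.* κ ℕ.+ 1))          ≤⟨ *-monoˡ-≤-nonNeg (proj₁ 0<ε) (proj₂ N-bound) ⟩
        ε * fromℕ (proj₁ N-bound)                     ≤⟨ *-monoˡ-≤-nonNeg (proj₁ 0<ε) (fromℕ-mono-≤ (ℕₚ.m≤n+m (proj₁ N-bound) 2)) ⟩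
        ε * λl                                      ∎
        where open ≤-Reasoning

      e≡2KK[1+l] : e ≡ two * K * K * (1# + λl)
      e≡2KK[1+l] = begin
        fromℕ (2 ℕ.* κ ℕ.* κ ℕ.* L)          ≡⟨ fromℕ-homo-* (2 ℕ.* κ ℕ.* κ) L ⟩
        fromℕ (2 ℕ.* κ ℕ.* κ) * fromℕ L      ≡⟨ cong (_* fromℕ L) (fromℕ-homo-* (2 ℕ.* κ) κ) ⟩
        fromℕ (2 ℕ.* κ) * K * fromℕ L        ≡⟨ cong (λ x → x * K * fromℕ L) (fromℕ-homo-* 2 κ) ⟩
        fromℕ 2 * K * K * fromℕ L            ≡⟨ cong (λ x → x * K * K * fromℕ L) two≡fromℕ2 ⟨
        two * K * K * (1# + λl)              ∎
        where open ≡-Reasoning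

      2αKl≤e : two * (α * (K * λl)) ≤ e
      2αKl≤e = begin
        two * (α * (K * λl))
          ≤⟨ *-monoˡ-≤-nonNeg 0≤two (*-mono-≤-nonNeg 0≤α (*-nonNegative (0≤fromℕ κ) (0≤fromℕ L))
               α≤K (*-monoˡ-≤-nonNeg (0≤fromℕ κ) (fromℕ-mono-≤ (ℕₚ.n≤1+n l)))) ⟩
        two * (K * (K * (1# + λl)))
          ≡⟨ solve 3 (λ t k l → t :* (k :* (k :* l)) := t :* k :* k :* l) refl two K (1# + λl) ⟩
        two * K * K * (1# + λl)
          ≡⟨ e≡2KK[1+l] ⟨
        e ∎
        where open ≤-Reasoning

      -- Here `w` and `u` are stripped of their common factor `L * P`. From `2 α + 1 ≤ ε l` follows
      -- `α (l + 2) + 1 ≤ κ l`, and that spare 1, multiplied by `E`, covers the first summand.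
      gap-ratio : two * (α * (K * λl)) + e * (α * (two + λl)) ≤ e * (K * λl)
      gap-ratio = begin
        two * (α * (K * λl)) + e * (α * (two + λl))
          ≤⟨ +-monoˡ-≤ _ 2αKl≤e ⟩
        e + e * (α * (two + λl))
          ≡⟨ cong (_+ e * (α * (two + λl))) (*-identityʳ e) ⟨
        e * 1# + e * (α * (two + λl))
          ≡⟨ solve 5 (λ e i α t l → e :* i :+ e :* (α :* (t :+ l)) := e :* ((t :* α :+ i) :+ α :* l)) refl e 1# α two λl ⟩
        e * ((two * α + 1#) + α * λl)
          ≤⟨ *-monoˡ-≤-nonNeg (0≤fromℕ E) (+-monoˡ-≤ (α * λl)
               (≤-trans (+-monoˡ-≤ 1# (*-monoˡ-≤-nonNeg 0≤two α≤K)) 2K+1≤ελl)) ⟩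
        e * (ε * λl + α * λl)
          ≡⟨ cong (e *_) (trans (+-comm _ _) (sym (distribʳ λl α ε))) ⟩
        e * ((α + ε) * λl)
          ≡⟨ cong (λ x → e * (x * λl)) α+ε≡κ ⟩
        e * (K * λl) ∎
        where open ≤-Reasoning

    gap : ∀ P → two * (α * fromℕ (L ℕ.* P ℕ.* (κ ℕ.* l))) + e * (α * fromℕ (L ℕ.* P ℕ.* suc L)) ≤
                e * fromℕ (L ℕ.* P ℕ.* (κ ℕ.* l))
    gap P = begin
      two * (α * fromℕ (L ℕ.* P ℕ.* (κ ℕ.* l))) + e * (α * fromℕ (L ℕ.* P ℕ.* suc L))
        ≡⟨ cong₂ (λ x y → two * (α * x) + e * (α * y)) w≡ u≡ ⟩
      two * (α * (c * (K * λl))) + e * (α * (c * (two + λl)))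
        ≡⟨ solve 6 (λ t α c w e u → t :* (α :* (c :* w)) :+ e :* (α :* (c :* u)) :=
             c :* (t :* (α :* w) :+ e :* (α :* u))) refl two α c (K * λl) e (two + λl) ⟩
      c * (two * (α * (K * λl)) + e * (α * (two + λl)))
        ≤⟨ *-monoˡ-≤-nonNeg (0≤fromℕ (L ℕ.* P)) gap-ratio ⟩
      c * (e * (K * λl))
        ≡⟨ solve 3 (λ c e w → c :* (e :* w) := e :* (c :* w)) refl c e (K * λl) ⟩
      e * (c * (K * λl))
        ≡⟨ cong (e *_) w≡ ⟨
      e * fromℕ (L ℕ.* P ℕ.* (κ ℕ.* l)) ∎
      where
      open ≤-Reasoning
      c : Carrier
      c = fromℕ (L ℕ.* P)
      w≡ : fromℕ (L ℕ.* P ℕ.* (κ ℕ.* l)) ≡ c * (K * λl)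
      w≡ = trans (fromℕ-homo-* (L ℕ.* P) (κ ℕ.* l)) (cong (c *_) (fromℕ-homo-* κ l))
      u≡ : fromℕ (L ℕ.* P ℕ.* suc L) ≡ c * (two + λl)
      u≡ = trans (fromℕ-homo-* (L ℕ.* P) (suc L)) (cong (c *_) (sym (+-assoc 1# 1# λl)))

  -- Fitting the construction into a ground set of given size.

  module Ground (κ′ : ℕ) (1≤κ′ : 1 ℕ.≤ κ′)
    {α : Carrier} (1≤α : 1# ≤ α)
    (l : ℕ) (2≤l : 2 ℕ.≤ l) (E : ℕ) (0<E : 0 ℕ.< E)
    (gap : ∀ P → (1# + 1#) * (α * fromℕ (suc l ℕ.* P ℕ.* (suc κ′ ℕ.* l))) + fromℕ E * (α * fromℕ (suc l ℕ.* P ℕ.* suc (suc l))) ≤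
                 fromℕ E * fromℕ (suc l ℕ.* P ℕ.* (suc κ′ ℕ.* l)))
    (m : ℕ) (E²≤2^m : E ℕ.* E ℕ.≤ 2 ℕ.^ m) (κ≤m : suc κ′ ℕ.≤ m) where

    private
      κ L : ℕ
      κ = suc κ′
      L = suc l

      1≤m : 1 ℕ.≤ m
      1≤m = ℕₚ.≤-trans (s≤s z≤n) κ≤m

      instance
        l-nonZero : NonZero l
        l-nonZero = ℕ.>-nonZero (ℕₚ.≤-trans (s≤s z≤n) 2≤l)

      -- Takes `s = m + g`: the factor `2 ^ m` absorbs `E * E` and leaves `2 ^ g`.
      hard-at-ground : ∀ q .{{_ : NonZero q}} g r → L ℕ.* (L ℕ.* (m ℕ.+ g)) ℕ.≤ q →
        HasHardDistribution (suc κ) α g (κ ℕ.* q ℕ.^ κ′ ℕ.* L ℕ.+ r)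
      hard-at-ground q g r L²s≤q = hiddenDistribution l r q (m ℕ.+ g) P L²s≤q cls wt ω wt-ω decay ∑-class L+1≤κl
        1≤α 0<w 0<E (gap P) {g} E²2^g≤2^s
        where
        open GeometricWeights κ′ q
        open ℕₚ.≤-Reasoning
        L+1≤κl : suc (suc l) ℕ.≤ κ ℕ.* l
        L+1≤κl = begin
          2 ℕ.+ l          ≤⟨ ℕₚ.+-monoˡ-≤ l 2≤l ⟩
          l ℕ.+ l          ≡⟨ cong (l ℕ.+_) (ℕₚ.+-identityʳ l) ⟨
          2 ℕ.* l          ≤⟨ ℕₚ.*-monoˡ-≤ l (s≤s 1≤κ′) ⟩
          κ ℕ.* l          ∎
        0<w : 0 ℕ.< L ℕ.* P ℕ.* (κ ℕ.* l)
        0<w = ℕₚ.*-mono-≤ (ℕₚ.*-mono-≤ (s≤s (z≤n {l})) (ℕₚ.m^n>0 q κ′))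
          (ℕₚ.*-mono-≤ (s≤s (z≤n {κ′})) (ℕₚ.≤-trans (s≤s z≤n) 2≤l))
        E²2^g≤2^s : E ℕ.* E ℕ.* 2 ℕ.^ g ℕ.≤ 2 ℕ.^ (m ℕ.+ g)
        E²2^g≤2^s = begin
          E ℕ.* E ℕ.* 2 ℕ.^ g         ≤⟨ ℕₚ.*-monoˡ-≤ (2 ℕ.^ g) E²≤2^m ⟩
          2 ℕ.^ m ℕ.* 2 ℕ.^ g         ≡⟨ ℕₚ.^-distribˡ-+-* 2 m g ⟨
          2 ℕ.^ (m ℕ.+ g)             ∎

    hard : ∀ {n} g → (L ℕ.* L ℕ.* (m ℕ.+ g)) ℕ.^ suc κ ℕ.≤ n → HasHardDistribution (suc κ) α g n
    hard {n} g q^k≤n = subst (HasHardDistribution (suc κ) α g) (ℕₚ.m+[n∸m]≡n (ℕₚ.≤-trans ground≤q^k q^k≤n))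
      (hard-at-ground q {{ℕ.>-nonZero (ℕₚ.≤-trans 1≤m m≤q)}} g (n ℕ.∸ κ ℕ.* q ℕ.^ κ′ ℕ.* L)
        (ℕₚ.≤-reflexive (sym (ℕₚ.*-assoc L L (m ℕ.+ g)))))
      where
      open ℕₚ.≤-Reasoning
      q : ℕ
      q = L ℕ.* L ℕ.* (m ℕ.+ g)
      m≤q : m ℕ.≤ q
      m≤q = ℕₚ.≤-trans (ℕₚ.m≤m+n m g) (ℕₚ.m≤n*m (m ℕ.+ g) (L ℕ.* L))
      L≤q : L ℕ.≤ q
      L≤q = begin
        L                           ≡⟨ ℕₚ.*-identityʳ L ⟨
        L ℕ.* 1                     ≤⟨ ℕₚ.*-mono-≤ (ℕₚ.m≤m*n L L) (ℕₚ.≤-trans 1≤m (ℕₚ.m≤m+n m g)) ⟩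
        q                           ∎
      ground≤q^k : κ ℕ.* q ℕ.^ κ′ ℕ.* L ℕ.≤ q ℕ.^ suc κ
      ground≤q^k = begin
        κ ℕ.* q ℕ.^ κ′ ℕ.* L        ≤⟨ ℕₚ.*-mono-≤ (ℕₚ.*-monoˡ-≤ (q ℕ.^ κ′) (ℕₚ.≤-trans κ≤m m≤q)) L≤q ⟩
        q ℕ.* q ℕ.^ κ′ ℕ.* q        ≡⟨ ℕₚ.*-comm (q ℕ.* q ℕ.^ κ′) q ⟩
        q ℕ.^ suc κ                 ∎

  -- Choosing the exponent for each ground-set size, and its growth.

  module Asymptotics (κ : ℕ)
    {α : Carrier}
    (a₀ m : ℕ) (1≤a₀ : 1 ℕ.≤ a₀) (1≤m : 1 ℕ.≤ m)
    (hard : ∀ {n} g → (a₀ ℕ.* (m ℕ.+ g)) ℕ.^ suc κ ℕ.≤ n → HasHardDistribution (suc κ) α g n) where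

    -- A ground set of `size g` elements admits the bound `2 ^ g`. As `size` is a polynomial of
    -- degree `κ + 1` in `g`, the exponent grows like the root of that order.
    scale size : ℕ → ℕ
    scale g = a₀ ℕ.* (m ℕ.+ g)
    size g = scale g ℕ.^ suc κ

    private
      n<size : ∀ n → n ℕ.< size n
      n<size n = begin-strict
        n                         <⟨ ℕₚ.+-monoˡ-≤ n 1≤m ⟩
        m ℕ.+ n                   ≡⟨ ℕₚ.*-identityˡ (m ℕ.+ n) ⟨
        1 ℕ.* (m ℕ.+ n)           ≤⟨ ℕₚ.*-monoˡ-≤ (m ℕ.+ n) 1≤a₀ ⟩
        scale n                   ≤⟨ ℕₚ.m≤m*n (scale n) (scale n ℕ.^ κ) {{ℕₚ.m^n≢0 (scale n) κ {{scale≢0}}}} ⟩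
        size n                    ∎
        where
        open ℕₚ.≤-Reasoning
        scale≢0 : NonZero (scale n)
        scale≢0 = ℕ.>-nonZero (ℕₚ.*-mono-≤ 1≤a₀ (ℕₚ.≤-trans 1≤m (ℕₚ.m≤m+n m n)))

    -- Filler for ground sets below `size 0`, where no hardness is claimed.
    additiveInstance : ∀ n → Instance (suc κ) n
    additiveInstance n = record
      { function = f
      ; isXOS    = (λ _ → f) , (λ _ → ∑[]-additive {n} (λ _ → 0#)) , λ X → (zero , refl) , λ _ → ≤-refl
      }
      where
      f : SetFunction n
      f X = ∑[ X ] (λ _ → 0#)

    position : ∀ n → n ℕ.< size 0 ⊎ ∃[ g ] size g ℕ.≤ n × n ℕ.< size (suc g)
    position n = last-below size n n (n<size n)

    exponent : ℕ → ℕ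
    exponent n with position n
    ... | inj₁ _       = 0
    ... | inj₂ (g , _) = g

    distribution : ∀ n → Distribution (Instance (suc κ) n)
    distribution n with position n
    ... | inj₁ _                = uniform 1 (s≤s z≤n) (λ _ → additiveInstance n)
    ... | inj₂ (g , size≤n , _) = proj₁ (hard g size≤n)

    distribution-hard : ∀ n → size 0 ℕ.≤ n → ∀ (A : Algorithm n) → IsApproximation (suc κ) α A →
      ∀ δ → 0# < δ → δ < 1# → 1# - δ ≤ Pr[calls≥ δ * fromℕ (2 ℕ.^ exponent n) ] (distribution n) A
    distribution-hard n size≤n with position n
    ... | inj₁ n<size           = ⊥-elim (ℕₚ.<⇒≱ n<size size≤n)
    ... | inj₂ (g , size≤n , _) = proj₂ (hard g size≤n)

    c : ℚ
    -- `mkℚ` stores the denominator minus one, so this is `1 / (κ + 1)`, that is `1 / k`.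
    c = mkℚ (ℤ.+ 1) κ (1-coprimeTo (suc κ))

    0<c : 0ℚ ℚ.< c
    0<c = ℚ.*<* (ℤ.+<+ (s≤s z≤n))

    -- From `n < size (g + 1)` and `g ≥ 1`, the scale at `g + 1` is at most `C * g`. The threshold
    -- `size 0 + size 1` rules out the exponent 0, for which `C * g` would vanish.
    exponent-Ω : exponent ∈Ω[n^ c ]
    exponent-Ω = C , size 0 ℕ.+ size 1 , n≤[Cg]^k
      where
      C : ℕ
      C = a₀ ℕ.* (m ℕ.+ 2)
      scale≤ : ∀ g → scale (suc (suc g)) ℕ.≤ C ℕ.* suc g
      scale≤ g = begin
        a₀ ℕ.* (m ℕ.+ (2 ℕ.+ g))                             ≤⟨ ℕₚ.*-monoʳ-≤ a₀ (ℕₚ.m≤m+n _ (m ℕ.* g ℕ.+ g)) ⟩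
        a₀ ℕ.* (m ℕ.+ (2 ℕ.+ g) ℕ.+ (m ℕ.* g ℕ.+ g))         ≡⟨ solveℕ 3 (λ a m g → a :*ℕ (m :+ℕ (conℕ 2 :+ℕ g) :+ℕ (m :*ℕ g :+ℕ g)) :=ℕ
                                                                  a :*ℕ (m :+ℕ conℕ 2) :*ℕ (conℕ 1 :+ℕ g)) refl a₀ m g ⟩
        C ℕ.* suc g                                      ∎
        where
        open ℕₚ.≤-Reasoning
        open +-*-Solver using () renaming (solve to solveℕ; _:*_ to _:*ℕ_; _:+_ to _:+ℕ_; _:=_ to _:=ℕ_; con to conℕ)
      n≤[Cg]^k : ∀ n → size 0 ℕ.+ size 1 ℕ.≤ n → n ℕ.^ 1 ℕ.≤ (C ℕ.* exponent n) ℕ.^ suc κ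
      n≤[Cg]^k n N≤n with position n
      ... | inj₁ n<size₀               = ⊥-elim (ℕₚ.<⇒≱ n<size₀ (ℕₚ.m+n≤o⇒m≤o (size 0) N≤n))
      ... | inj₂ (zero , _ , n<size₁)  = ⊥-elim (ℕₚ.<⇒≱ n<size₁ (ℕₚ.m+n≤o⇒n≤o (size 0) N≤n))
      ... | inj₂ (suc g , _ , n<size)  = begin
        n ℕ.^ 1                          ≡⟨ ℕₚ.^-identityʳ n ⟩
        n                                ≤⟨ ℕₚ.<⇒≤ n<size ⟩
        scale (suc (suc g)) ℕ.^ suc κ        ≤⟨ ℕₚ.^-monoˡ-≤ (suc κ) (scale≤ g) ⟩
        (C ℕ.* suc g) ℕ.^ suc κ              ∎
        where open ℕₚ.≤-Reasoning

-- Hardness for every factor `k - 1 - ε`, with all constants fixed.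

theorem5 : ∀ {a ℓ} (R : ArchimedeanOrderedField a ℓ) →
    let open ArchimedeanOrderedField R
        open XOS R in
    ∀ (k : ℕ) → 3 ℕ.≤ k →
    ∀ (ε : Carrier) → 0# < ε →
    let α = fromℕ k - 1# - ε in
    1# ≤ α →
    Σ[ c ∈ ℚ ] 0ℚ ℚ.< c ×
    Σ[ D ∈ (∀ n → Distribution (Instance k n)) ]
    Σ[ g ∈ (ℕ → ℕ) ] g ∈Ω[n^ c ] ×
    ∃[ n₀ ]
    (∀ (A : ∀ n → Algorithm n) → (∀ n → IsApproximation k α (A n)) →
     ∀ (δ : Carrier) → 0# < δ → δ < 1# →
     ∀ n → n₀ ℕ.≤ n →
     1# - δ ≤ Pr[calls≥ δ * fromℕ (2 ℕ.^ g n) ] (D n) (A n))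
theorem5 R (suc (suc κ′)) (s≤s (s≤s 1≤κ′)) ε 0<ε 1≤α =
  c , 0<c , distribution , exponent , exponent-Ω , size 0 ,
  λ A A-approx δ 0<δ δ<1 n size≤n → distribution-hard n size≤n (A n) (A-approx n) δ 0<δ δ<1
  where
  open ArchimedeanOrderedField R
  open OrderedField R
  α+ε≡κ : fromℕ (suc (suc κ′)) - 1# - ε + ε ≡ fromℕ (suc κ′)
  α+ε≡κ = begin
    fromℕ (suc (suc κ′)) - 1# - ε + ε        ≡⟨ trans (+-comm _ ε) (x+y-x≡y ε _) ⟩
    1# + fromℕ (suc κ′) - 1#                 ≡⟨ +-assoc 1# (fromℕ (suc κ′)) (- 1#) ⟩
    1# + (fromℕ (suc κ′) - 1#)               ≡⟨ x+y-x≡y 1# (fromℕ (suc κ′)) ⟩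
    fromℕ (suc κ′)                           ∎
    where open ≡-Reasoning
  open Gap R (suc κ′) 0<ε 1≤α α+ε≡κ using (l; L; E; gap)
  -- `m = E * E + κ` meets both demands on `m`: `E * E ≤ 2 ^ m` and `κ ≤ m`. The factor `L * L` is
  -- the ratio of `q` to `s`.
  open Asymptotics R (suc κ′) (L ℕ.* L) (E ℕ.* E ℕ.+ suc κ′) (s≤s z≤n) (ℕₚ.≤-trans (s≤s z≤n) (ℕₚ.m≤n+m (suc κ′) (E ℕ.* E)))
    (Ground.hard R κ′ 1≤κ′ 1≤α l (s≤s (s≤s z≤n)) E (s≤s z≤n) gap (E ℕ.* E ℕ.+ suc κ′)
      (ℕₚ.≤-trans (ℕₚ.m≤m+n (E ℕ.* E) (suc κ′)) (ℕₚ.<⇒≤ (n<2^n (E ℕ.* E ℕ.+ suc κ′))))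
      (ℕₚ.m≤n+m (suc κ′) (E ℕ.* E)))
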